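{- Let $w\ge 1$ be an integer, let $U=\{0,1,\ldots,2^w-1\}$, let $a$ be a uniformly random odd integer in $\{0,\ldots,2^w-1\}$, and let $t$ be a uniformly random integer in $\{0,\ldots,2^w-1\}$, independent of $a$. Define the random sampling function $\mathit{Sample}:U\to\{0,1\}$ by $\mathit{Sample}(x)=1$ if $(ax \bmod 2^w)\le t$ and $\mathit{Sample}(x)=0$ otherwise. Then $\mathit{Sample}$ is a distinguisher with probability $1/8$: for every commutative monoid $R$ and every function $v:U\to R$ with $v(x)\neq 0$ for at least one $x\in U$, \[\Pr_{a,t}\Big[\sum\{v(x)\mid x\in U,\ \mathit{Sample}(x)=1\}\neq 0\Big]\ \ge\ 1/8.\]
   Context: A commutative monoid is a set with a commutative, associative addition having a neutral element $0$. The sum $\sum\{v(x)\mid x\in U,\ \mathit{Sample}(x)=1\}$ is the sum in $R$ of the values of the sampled keys (the empty sum is $0$). -}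

module Defs where

open import Level using (Level)
open import Data.Bool using (Bool; true; false; if_then_else_)
open import Data.Nat using (ℕ; _*_; _^_; _%_; _≤ᵇ_)
open import Data.Nat.Properties using (m^n≢0)
open import Data.Fin using (Fin; toℕ)
open import Data.List using (List; foldr; allFin)
open import Algebra.Bundles using (CommutativeMonoid)

2^ : ℕ → ℕ
2^ w = 2 ^ w

mulMod : (w a x : ℕ) → ℕ
mulMod w a x = _%_ (a * x) (2 ^ w) {{m^n≢0 2 w}}

sample : (w a t : ℕ) → Fin (2 ^ w) → Bool
sample w a t x = mulMod w a (toℕ x) ≤ᵇ t

sampledSum : ∀ {c ℓ} (R : CommutativeMonoid c ℓ) (w a t : ℕ) →
             (Fin (2 ^ w) → CommutativeMonoid.Carrier R) →
             CommutativeMonoid.Carrier R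
sampledSum R w a t v =
  foldr (λ x acc → if sample w a t x then v x ∙ acc else acc) ε (allFin (2 ^ w))
  where open CommutativeMonoid R

open import Data.Product using (_×_; _,_)
open import Data.Nat using (_<_)
open import Relation.Nullary using (¬_)
open import Relation.Binary.PropositionalEquality using (_≡_)

GoodOutcome : ∀ {c ℓ} (R : CommutativeMonoid c ℓ) (w : ℕ) →
              (Fin (2 ^ w) → CommutativeMonoid.Carrier R) → ℕ × ℕ → Set ℓ
GoodOutcome R w v (a , t) =
  a < 2 ^ w × a % 2 ≡ 1 × t < 2 ^ w ×
  ¬ CommutativeMonoid._≈_ R (sampledSum R w a t v) (CommutativeMonoid.ε R)

module Submission where

-- Scale the hash positions by Q = 2n, where n is the number of nonzero keys, and count
-- shifts τ modulo K = NQ (N = 2^w). A window of length N modulo K then has expected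
-- content exactly n N / K = 1/2, and since a x and a y are close no more often than
-- for independent positions, a second moment estimate shows that the window contains
-- exactly one nonzero key with probability at least 1/4. The sampled sums at the two ends
-- of such a window differ by one nonzero value, so they do not both vanish: half of 1/4 remains.
-- A window that wraps around needs the total to be zero or v(0) to be nonzero;
-- otherwise negating a turns prefixes into suffixes, so that the samples (a, t) and
-- (−a, N−1−t) partition the nonzero keys and one of the two sums is nonzero.

open import Defs
open import Algebra.Bundles using (CommutativeMonoid)
open import Data.Bool using (Bool; true; false; not; if_then_else_)
open import Data.Fin using (Fin; toℕ; fromℕ<)
import Data.Fin.Properties as Fin
open import Data.List using (List; []; _∷_; _++_; map; foldr; filter; length; allFin; downFrom; cartesianProduct)
open import Data.List.Membership.Propositional using (_∈_; find; lose)
open import Data.List.Membership.Propositional.Properties using (∈-allFin; ∈-filter⁺; ∈-downFrom⁺; ∈-downFrom⁻)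
open import Data.List.Properties using (length-downFrom; map-∘)
open import Data.List.Relation.Unary.All as All using (All; []; _∷_)
open import Data.List.Relation.Unary.All.Properties using (all-filter)
open import Data.List.Relation.Unary.AllPairs using ([]; _∷_)
open import Data.List.Relation.Unary.Any using (Any; here; there; any?)
open import Data.List.Relation.Unary.Unique.Propositional using (Unique)
open import Data.List.Relation.Unary.Unique.Propositional.Properties
  using (downFrom⁺; filter⁺; allFin⁺; map⁺; cartesianProduct⁺)
open import Data.Nat
open import Data.Nat.DivMod
open import Data.Nat.Divisibility
open import Data.Nat.ListAction using (sum)
open import Data.Nat.Properties
open import Data.Nat.Tactic.RingSolver using (solve-∀)
open import Data.Product using (_×_; _,_; ∃-syntax)
open import Data.Sum using (_⊎_; inj₁; inj₂; [_,_]′)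
open import Data.Unit using (tt)
open import Effect.Monad using (RawMonad)
open import Function using (_∘_; mk⇔)
open import Level using (Level)
open import Relation.Binary.PropositionalEquality
open import Relation.Nullary using (¬_; ¬?; Dec; yes; no; does; contradiction)
open import Relation.Nullary.Decidable using (does-⇔; ¬¬-excluded-middle)
open import Relation.Nullary.Negation using (¬¬-Monad)

private
  variable
    ℓ₁ ℓ₂ : Level
    A : Set ℓ₁
    B : Set ℓ₂
    P : Set ℓ₁
    P′ : Set ℓ₂

-- Indicators of decidable propositions

𝟙 : Bool → ℕ
𝟙 b = if b then 1 else 0

⟦_⟧ : Dec P → ℕ
⟦ P? ⟧ = 𝟙 (does P?)

⟦⟧-true : (P? : Dec P) → P → ⟦ P? ⟧ ≡ 1
⟦⟧-true (yes _) _ = refl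
⟦⟧-true (no ¬p) p = contradiction p ¬p

⟦⟧-false : (P? : Dec P) → ¬ P → ⟦ P? ⟧ ≡ 0
⟦⟧-false (yes p) ¬p = contradiction p ¬p
⟦⟧-false (no _)  _  = refl

⟦⟧-mono : (P? : Dec P) (P′? : Dec P′) → (P → P′) → ⟦ P? ⟧ ≤ ⟦ P′? ⟧
⟦⟧-mono (yes p) P′? f = ≤-reflexive (sym (⟦⟧-true P′? (f p)))
⟦⟧-mono (no _)  P′? f = z≤n

⟦⟧-cong : (P? : Dec P) (P′? : Dec P′) → (P → P′) → (P′ → P) → ⟦ P? ⟧ ≡ ⟦ P′? ⟧
⟦⟧-cong P? P′? f g = ≤-antisym (⟦⟧-mono P? P′? f) (⟦⟧-mono P′? P? g)

-- Since `Q?` decides, refuting `¬ Q` is enough. In this form, facts about undecided equalities in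
-- the monoid can feed a numerical inequality.
⟦⟧≤+ : ∀ {ℓ} {Q : Set ℓ} (P? : Dec P) (P′? : Dec P′) (Q? : Dec Q) →
       (P → ¬ P′ → ¬ ¬ Q) → ⟦ P? ⟧ ≤ ⟦ P′? ⟧ + ⟦ Q? ⟧
⟦⟧≤+ (no _)  _       _       _ = z≤n
⟦⟧≤+ (yes _) (yes _) _       _ = s≤s z≤n
⟦⟧≤+ (yes _) (no _)  (yes _) _ = s≤s z≤n
⟦⟧≤+ (yes p) (no ¬q) (no ¬s) h = contradiction ¬s (h p ¬q)

-- Finite sums of natural numbers

∑ : List A → (A → ℕ) → ℕ
∑ xs f = sum (map f xs)

-- Summing over `downFrom` makes `∑< (suc n) f` reduce to `f n + ∑< n f`, so the top term splits off
-- by computation.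
∑< : ℕ → (ℕ → ℕ) → ℕ
∑< n = ∑ (downFrom n)

infix 4 ∑ ∑<
syntax ∑ xs (λ x → e) = ∑[ x ∈ xs ] e
syntax ∑< n (λ i → e) = ∑[ i < n ] e

∑-mono : ∀ {f g : A → ℕ} xs → (∀ {x} → x ∈ xs → f x ≤ g x) → ∑ xs f ≤ ∑ xs g
∑-mono []       _ = z≤n
∑-mono (x ∷ xs) h = +-mono-≤ (h (here refl)) (∑-mono xs (h ∘ there))

∑-cong : ∀ {f g : A → ℕ} xs → (∀ {x} → x ∈ xs → f x ≡ g x) → ∑ xs f ≡ ∑ xs g
∑-cong []       _ = refl
∑-cong (x ∷ xs) h = cong₂ _+_ (h (here refl)) (∑-cong xs (h ∘ there))

∑-+ : ∀ (f g : A → ℕ) xs → (∑[ x ∈ xs ] (f x + g x)) ≡ ∑ xs f + ∑ xs g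
∑-+ f g []       = refl
∑-+ f g (x ∷ xs) = trans (cong (f x + g x +_) (∑-+ f g xs)) (lemma (f x) (g x) _ _)
  where
  lemma : ∀ a b c d → a + b + (c + d) ≡ a + c + (b + d)
  lemma = solve-∀

∑-*ˡ : ∀ c (f : A → ℕ) xs → (∑[ x ∈ xs ] (c * f x)) ≡ c * ∑ xs f
∑-*ˡ c f []       = sym (*-zeroʳ c)
∑-*ˡ c f (x ∷ xs) = trans (cong (c * f x +_) (∑-*ˡ c f xs)) (sym (*-distribˡ-+ c (f x) _))

∑-const : ∀ c (xs : List A) → (∑[ _ ∈ xs ] c) ≡ length xs * c
∑-const c []       = refl
∑-const c (x ∷ xs) = cong (c +_) (∑-const c xs)

∑-zero : ∀ {f : A → ℕ} xs → (∀ {x} → x ∈ xs → f x ≡ 0) → ∑ xs f ≡ 0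
∑-zero xs h = trans (∑-cong xs h) (trans (∑-const 0 xs) (*-zeroʳ (length xs)))

∑-swap : ∀ (f : A → B → ℕ) xs ys → (∑[ x ∈ xs ] ∑[ y ∈ ys ] f x y) ≡ (∑[ y ∈ ys ] ∑[ x ∈ xs ] f x y)
∑-swap f []       ys = sym (∑-zero ys (λ _ → refl))
∑-swap f (x ∷ xs) ys = trans (cong (∑ ys (f x) +_) (∑-swap f xs ys)) (sym (∑-+ (f x) _ ys))

∑-*-∑ : ∀ (f : A → ℕ) (g : B → ℕ) xs ys → ∑ xs f * ∑ ys g ≡ (∑[ x ∈ xs ] ∑[ y ∈ ys ] (f x * g y))
∑-*-∑ f g []       ys = refl
∑-*-∑ f g (x ∷ xs) ys = trans (*-distribʳ-+ (∑ ys g) (f x) (∑ xs f))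
  (cong₂ _+_ (sym (∑-*ˡ (f x) g ys)) (∑-*-∑ f g xs ys))

∑-atMostOne : ∀ {P : A → Set ℓ₂} (P? : ∀ x → Dec (P x)) {xs} → Unique xs →
              (∀ {x y} → x ∈ xs → y ∈ xs → P x → P y → x ≡ y) →
              (∑[ x ∈ xs ] ⟦ P? x ⟧) ≤ 1
∑-atMostOne P? []                 _ = z≤n
∑-atMostOne P? {x ∷ xs} (x∉ ∷ u) h with P? x
... | no  _  = ∑-atMostOne P? u (λ i j → h (there i) (there j))
... | yes Px = ≤-reflexive (cong suc (∑-zero xs λ {y} i →
  ⟦⟧-false (P? y) λ Py → All.lookup x∉ i (h (here refl) (there i) Px Py)))

∑<-mono : ∀ {f g : ℕ → ℕ} n → (∀ {i} → i < n → f i ≤ g i) → ∑< n f ≤ ∑< n g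
∑<-mono n h = ∑-mono (downFrom n) (h ∘ ∈-downFrom⁻)

∑<-cong : ∀ {f g : ℕ → ℕ} n → (∀ {i} → i < n → f i ≡ g i) → ∑< n f ≡ ∑< n g
∑<-cong n h = ∑-cong (downFrom n) (h ∘ ∈-downFrom⁻)

∑<-const : ∀ c n → (∑[ _ < n ] c) ≡ n * c
∑<-const c n = trans (∑-const c (downFrom n)) (cong (_* c) (length-downFrom n))

∑<-zero : ∀ {f : ℕ → ℕ} n → (∀ {i} → i < n → f i ≡ 0) → ∑< n f ≡ 0
∑<-zero n h = ∑-zero (downFrom n) (h ∘ ∈-downFrom⁻)

∑<-≤ : ∀ {f : ℕ → ℕ} c n → (∀ {i} → i < n → f i ≤ c) → ∑< n f ≤ n * c
∑<-≤ c n h = ≤-trans (∑<-mono n h) (≤-reflexive (∑<-const c n))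

∑<-atMostOne : ∀ {P : ℕ → Set ℓ₂} (P? : ∀ i → Dec (P i)) n →
               (∀ {i j} → i < n → j < n → P i → P j → i ≡ j) →
               (∑[ i < n ] ⟦ P? i ⟧) ≤ 1
∑<-atMostOne P? n h = ∑-atMostOne P? (downFrom⁺ n) λ i j → h (∈-downFrom⁻ i) (∈-downFrom⁻ j)

∑<-split : ∀ m n (f : ℕ → ℕ) → ∑< (m + n) f ≡ ∑< m f + (∑[ i < n ] f (m + i))
∑<-split m zero    f = trans (cong (λ k → ∑< k f) (+-identityʳ m)) (sym (+-identityʳ _))
∑<-split m (suc n) f = trans (cong (λ k → ∑< k f) (+-suc m n))
  (trans (cong (f (m + n) +_) (∑<-split m n f)) (lemma (f (m + n)) (∑< m f) _))
  where
  lemma : ∀ a b c → a + (b + c) ≡ b + (a + c)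
  lemma = solve-∀

∑<-reverse : ∀ n (f : ℕ → ℕ) → (∑[ i < n ] f (n ∸ suc i)) ≡ ∑< n f
∑<-reverse zero    f = refl
∑<-reverse (suc n) f = begin
  (∑[ i < suc n ] f (n ∸ i))                    ≡⟨ ∑<-split 1 n (λ i → f (n ∸ i)) ⟩
  f n + 0 + (∑[ i < n ] f (n ∸ suc i))          ≡⟨ cong₂ _+_ (+-identityʳ (f n)) (∑<-reverse n f) ⟩
  ∑< (suc n) f                                  ∎
  where open ≡-Reasoning

-- Moving the start from `c` to `suc c` trades the term `f c` for `f (c + K)`, which has the same
-- value.
∑<-periodic : ∀ K (f : ℕ → ℕ) → (∀ z → f (z + K) ≡ f z) → ∀ c → (∑[ i < K ] f (c + i)) ≡ ∑< K f
∑<-periodic K f per zero    = refl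
∑<-periodic K f per (suc c) = trans step (∑<-periodic K f per c)
  where
  open ≡-Reasoning
  step : (∑[ i < K ] f (suc c + i)) ≡ (∑[ i < K ] f (c + i))
  -- Both sides come from the `suc K` terms starting at `c`: one way splits off the first term, the
  -- other, by computation, the last.
  step = +-cancelˡ-≡ (f (c + 0)) _ _ (begin
    f (c + 0) + (∑[ i < K ] f (suc c + i))
      ≡⟨ cong₂ _+_ (sym (+-identityʳ _)) (∑<-cong K λ {i} _ → cong f (sym (+-suc c i))) ⟩
    (f (c + 0) + 0) + (∑[ i < K ] f (c + (1 + i)))
      ≡⟨ ∑<-split 1 K (λ i → f (c + i)) ⟨
    f (c + K) + (∑[ i < K ] f (c + i))
      ≡⟨ cong (_+ (∑[ i < K ] f (c + i))) (trans (per c) (cong f (sym (+-identityʳ c)))) ⟩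
    f (c + 0) + (∑[ i < K ] f (c + i)) ∎)

∑<-restrict : ∀ {N K} (f : ℕ → ℕ) → N ≤ K → (∑[ i < K ] (⟦ i <? N ⟧ * f i)) ≡ ∑< N f
∑<-restrict {N} {K} f N≤K = begin
  ∑< K g                                        ≡⟨ cong (λ k → ∑< k g) (m+[n∸m]≡n N≤K) ⟨
  ∑< (N + (K ∸ N)) g                            ≡⟨ ∑<-split N (K ∸ N) g ⟩
  ∑< N g + (∑[ i < K ∸ N ] g (N + i))           ≡⟨ cong₂ _+_ (∑<-cong N below) (∑<-zero (K ∸ N) λ {i} _ → above i) ⟩
  ∑< N f + 0                                    ≡⟨ +-identityʳ _ ⟩
  ∑< N f                                        ∎
  where
  open ≡-Reasoning
  g = λ i → ⟦ i <? N ⟧ * f i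
  below : ∀ {i} → i < N → g i ≡ f i
  below {i} i<N = trans (cong (_* f i) (⟦⟧-true (i <? N) i<N)) (+-identityʳ _)
  above : ∀ i → g (N + i) ≡ 0
  above i = cong (_* f (N + i)) (⟦⟧-false (N + i <? N) (m+n≮m N i))

∑<-blocks : ∀ Q .{{_ : NonZero Q}} n (f : ℕ → ℕ) → (∑[ i < n * Q ] f (i / Q)) ≡ Q * ∑< n f
∑<-blocks Q zero    f = sym (*-zeroʳ Q)
∑<-blocks Q (suc n) f = begin
  (∑[ i < Q + n * Q ] f (i / Q))                                    ≡⟨ cong (λ k → ∑[ i < k ] f (i / Q)) (+-comm Q (n * Q)) ⟩
  (∑[ i < n * Q + Q ] f (i / Q))                                    ≡⟨ ∑<-split (n * Q) Q _ ⟩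
  (∑[ i < n * Q ] f (i / Q)) + (∑[ i < Q ] f ((n * Q + i) / Q))     ≡⟨ cong₂ _+_ (∑<-blocks Q n f) (trans (∑<-cong Q last) (∑<-const (f n) Q)) ⟩
  Q * ∑< n f + Q * f n                                              ≡⟨ lemma Q _ _ ⟩
  Q * (f n + ∑< n f)                                                ∎
  where
  open ≡-Reasoning
  lemma : ∀ a b c → a * b + a * c ≡ a * (c + b)
  lemma = solve-∀
  last : ∀ {i} → i < Q → f ((n * Q + i) / Q) ≡ f n
  last {i} i<Q = cong f (trans (+-distrib-/-∣ˡ i (n∣m*n n))
    (trans (cong₂ _+_ (m*n/n≡m n Q) (m<n⇒m/n≡0 i<Q)) (+-identityʳ n)))

∑<-+ : ∀ (f g : ℕ → ℕ) n → (∑[ i < n ] (f i + g i)) ≡ ∑< n f + ∑< n g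
∑<-+ f g n = ∑-+ f g (downFrom n)

∑<-swap : ∀ (f : ℕ → ℕ → ℕ) m n → (∑[ i < m ] ∑[ j < n ] f i j) ≡ (∑[ j < n ] ∑[ i < m ] f i j)
∑<-swap f m n = ∑-swap f (downFrom m) (downFrom n)

∑<-*ˡ : ∀ c (f : ℕ → ℕ) n → (∑[ i < n ] (c * f i)) ≡ c * ∑< n f
∑<-*ˡ c f n = ∑-*ˡ c f (downFrom n)

∑-≥ : ∀ (f : A → ℕ) {xs x} → x ∈ xs → f x ≤ ∑ xs f
∑-≥ f (here refl)             = m≤m+n _ _
∑-≥ f {y ∷ _} (there x∈xs) = ≤-trans (∑-≥ f x∈xs) (m≤n+m _ (f y))

∑<-≥ : ∀ (f : ℕ → ℕ) {i n} → i < n → f i ≤ ∑< n f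
∑<-≥ f i<n = ∑-≥ f (∈-downFrom⁺ i<n)

∑-push : ∀ (f : ℕ → ℕ → A → ℕ) xs m n →
         (∑[ i < m ] ∑[ j < n ] ∑[ x ∈ xs ] f i j x) ≡ (∑[ x ∈ xs ] ∑[ i < m ] ∑[ j < n ] f i j x)
∑-push f xs m n = trans
  (∑<-cong m λ {i} _ → ∑-swap (f i) (downFrom n) xs)
  (∑-swap (λ i x → ∑[ j < n ] f i j x) (downFrom m) xs)

length-filter≡∑ : ∀ {P : A → Set ℓ₂} (P? : ∀ x → Dec (P x)) xs →
                  length (filter P? xs) ≡ (∑[ x ∈ xs ] ⟦ P? x ⟧)
length-filter≡∑ P? []       = refl
length-filter≡∑ P? (x ∷ xs) with P? x
... | yes _ = cong suc (length-filter≡∑ P? xs)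
... | no  _ = length-filter≡∑ P? xs

∑-map : ∀ (f : A → B) (g : B → ℕ) xs → ∑ (map f xs) g ≡ ∑ xs (g ∘ f)
∑-map f g xs = cong sum (sym (map-∘ xs))

∑-++ : ∀ (f : A → ℕ) xs ys → ∑ (xs ++ ys) f ≡ ∑ xs f + ∑ ys f
∑-++ f []       ys = refl
∑-++ f (x ∷ xs) ys = trans (cong (f x +_) (∑-++ f xs ys)) (sym (+-assoc (f x) _ _))

∑-cartesianProduct : ∀ (f : A × B → ℕ) xs ys →
                     ∑ (cartesianProduct xs ys) f ≡ (∑[ x ∈ xs ] ∑[ y ∈ ys ] f (x , y))
∑-cartesianProduct f []       ys = refl
∑-cartesianProduct f (x ∷ xs) ys = trans (∑-++ f (map (x ,_) ys) (cartesianProduct xs ys))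
  (cong₂ _+_ (∑-map (x ,_) f ys) (∑-cartesianProduct f xs ys))

-- Pairwise collisions of the scaled hash positions

%-≡⇒∣ : ∀ m k d .{{_ : NonZero d}} → m % d ≡ (m + k) % d → d ∣ k
%-≡⇒∣ m k d eq = ∣m+n∣m⇒∣n (divides ((m + k) / d) shifted) (n∣m*n (m / d))
  where
  open ≡-Reasoning
  shifted : m / d * d + k ≡ (m + k) / d * d
  shifted = +-cancelˡ-≡ (m % d) _ _ (begin
    m % d + (m / d * d + k)           ≡⟨ +-assoc (m % d) _ k ⟨
    m % d + m / d * d + k             ≡⟨ cong (_+ k) (m≡m%n+[m/n]*n m d) ⟨
    m + k                             ≡⟨ m≡m%n+[m/n]*n (m + k) d ⟩
    (m + k) % d + (m + k) / d * d     ≡⟨ cong (_+ (m + k) / d * d) eq ⟨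
    m % d + (m + k) / d * d           ∎)

%-shift-injective : ∀ c d .{{_ : NonZero d}} {i j} → i < d → j < d → (c + i) % d ≡ (c + j) % d → i ≡ j
%-shift-injective c d i<d j<d eq = [ (λ i≤j → ordered j<d i≤j eq) , (λ j≤i → sym (ordered i<d j≤i (sym eq))) ]′ (≤-total _ _)
  where
  ordered : ∀ {i j} → j < d → i ≤ j → (c + i) % d ≡ (c + j) % d → i ≡ j
  ordered {i} j<d i≤j eq with m≤n⇒∃[o]m+o≡n i≤j
  ... | zero  , refl = sym (+-identityʳ i)
  ... | suc k , refl = contradiction
    (%-≡⇒∣ (c + i) (suc k) d (trans eq (cong (_% d) (sym (+-assoc c i (suc k))))))
    (>⇒∤ (≤-<-trans (m≤n+m (suc k) i) j<d))

even⊎odd : ∀ m → (∃[ k ] m ≡ 2 * k) ⊎ (∃[ k ] m ≡ 1 + 2 * k)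
even⊎odd zero = inj₁ (0 , refl)
even⊎odd (suc m) with even⊎odd m
... | inj₁ (k , refl) = inj₂ (k , refl)
... | inj₂ (k , refl) = inj₁ (suc k , lemma k)
  where
  lemma : ∀ k → suc (1 + 2 * k) ≡ 2 * suc k
  lemma = solve-∀

-- Factors 2 of `m` are peeled off one at a time; if `m` is odd, the product is odd and not even 2
-- divides it.
2^k∣m*odd⇒2^k∣m : ∀ k m e → 2 ^ k ∣ m * (1 + 2 * e) → 2 ^ k ∣ m
2^k∣m*odd⇒2^k∣m zero    m e _ = 1∣ m
2^k∣m*odd⇒2^k∣m (suc k) m e div with even⊎odd m
... | inj₁ (m′ , refl) = *-monoʳ-∣ 2 (2^k∣m*odd⇒2^k∣m k m′ e
        (*-cancelˡ-∣ 2 (subst (2 * 2 ^ k ∣_) (*-assoc 2 m′ (1 + 2 * e)) div)))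
... | inj₂ (m′ , refl) with ∣-trans (m∣m*n (2 ^ k)) div
...   | divides r eq = contradiction (trans (sym (trans eq (*-comm r 2))) (lemma m′ e))
                         (even≢odd r (m′ + e + 2 * m′ * e))
  where
  lemma : ∀ m e → (1 + 2 * m) * (1 + 2 * e) ≡ suc (2 * (m + e + 2 * m * e))
  lemma = solve-∀

-- When δ is odd, a δ Q runs through the odd multiples of Q, that is, the residue Q modulo 2Q.
oppositePairs : (Q : ℕ) .{{_ : NonZero (2 * Q)}} → ℕ → ℕ
oppositePairs Q D = ∑[ u < D ] ∑[ v < D ] ⟦ (u + Q) % (2 * Q) ≟ v % (2 * Q) ⟧

module _ (Q : ℕ) .{{_ : NonZero (2 * Q)}} where

  private
    R = 2 * Q
    E : ℕ → ℕ → ℕ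
    E u v = ⟦ (u + Q) % R ≟ v % R ⟧

    row : ∀ u c n → n ≤ R → (∑[ v < n ] E u (c + v)) ≤ 1
    row u c n n≤R = ∑<-atMostOne (λ v → (u + Q) % R ≟ (c + v) % R) n λ i<n j<n p q →
      %-shift-injective c R (<-≤-trans i<n n≤R) (<-≤-trans j<n n≤R) (trans (sym p) q)

    col : ∀ v → (∑[ u < R ] E u v) ≤ 1
    col v = ∑<-atMostOne (λ u → (u + Q) % R ≟ v % R) R λ {i} {j} i<R j<R p q →
      %-shift-injective Q R i<R j<R (trans (cong (_% R) (+-comm Q i)) (trans p
        (trans (sym q) (cong (_% R) (+-comm j Q)))))

    -- The square of side `R + D` consists of a translate by `R` of the square of side `D`, with
    -- equally many pairs, and an L-shaped border. Among `R` consecutive values each residue occurs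
    -- once, so the border holds at most `R + D + D` pairs, and `R` times that is `(R + D)² − D²`.
    large : ∀ D → R * oppositePairs Q D ≤ D * D → R * oppositePairs Q (R + D) ≤ (R + D) * (R + D)
    large D ih = begin
      R * (∑[ u < R + D ] ∑[ v < R + D ] E u v)
        ≡⟨ cong (R *_) (∑<-split R D _) ⟩
      R * ((∑[ u < R ] ∑[ v < R + D ] E u v) + (∑[ u < D ] ∑[ v < R + D ] E (R + u) v))
        ≤⟨ *-monoʳ-≤ R (+-mono-≤ top bottom) ⟩
      R * ((R * 1 + D * 1) + (D * 1 + oppositePairs Q D))
        ≡⟨ expand R D (oppositePairs Q D) ⟩
      R * R + 2 * (R * D) + R * oppositePairs Q D
        ≤⟨ +-monoʳ-≤ (R * R + 2 * (R * D)) ih ⟩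
      R * R + 2 * (R * D) + D * D
        ≡⟨ square R D ⟩
      (R + D) * (R + D) ∎
      where
      open ≤-Reasoning
      expand : ∀ r d c → r * ((r * 1 + d * 1) + (d * 1 + c)) ≡ r * r + 2 * (r * d) + r * c
      expand = solve-∀
      square : ∀ r d → r * r + 2 * (r * d) + d * d ≡ (r + d) * (r + d)
      square = solve-∀
      top : (∑[ u < R ] ∑[ v < R + D ] E u v) ≤ R * 1 + D * 1
      top = begin
        (∑[ u < R ] ∑[ v < R + D ] E u v)
          ≡⟨ ∑<-cong R (λ {u} _ → ∑<-split R D (E u)) ⟩
        (∑[ u < R ] (∑< R (E u) + (∑[ v < D ] E u (R + v))))
          ≡⟨ ∑<-+ (λ u → ∑< R (E u)) (λ u → ∑[ v < D ] E u (R + v)) R ⟩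
        (∑[ u < R ] ∑< R (E u)) + (∑[ u < R ] ∑[ v < D ] E u (R + v))
          ≤⟨ +-mono-≤ (∑<-≤ 1 R λ {u} _ → row u 0 R ≤-refl)
               (≤-trans (≤-reflexive (∑<-swap (λ u v → E u (R + v)) R D)) (∑<-≤ 1 D λ {v} _ → col (R + v))) ⟩
        R * 1 + D * 1 ∎
      shift : ∀ u v → E (R + u) (R + v) ≡ E u v
      shift u v = cong₂ (λ x y → ⟦ x ≟ y ⟧)
        (trans (cong (_% R) (trans (+-assoc R u Q) (+-comm R (u + Q)))) ([m+n]%n≡m%n (u + Q) R))
        (trans (cong (_% R) (+-comm R v)) ([m+n]%n≡m%n v R))
      bottom : (∑[ u < D ] ∑[ v < R + D ] E (R + u) v) ≤ D * 1 + oppositePairs Q D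
      bottom = begin
        (∑[ u < D ] ∑[ v < R + D ] E (R + u) v)
          ≡⟨ ∑<-cong D (λ {u} _ → ∑<-split R D (E (R + u))) ⟩
        (∑[ u < D ] (∑< R (E (R + u)) + (∑[ v < D ] E (R + u) (R + v))))
          ≡⟨ ∑<-+ (λ u → ∑< R (E (R + u))) (λ u → ∑[ v < D ] E (R + u) (R + v)) D ⟩
        (∑[ u < D ] ∑< R (E (R + u))) + (∑[ u < D ] ∑[ v < D ] E (R + u) (R + v))
          ≤⟨ +-mono-≤ (∑<-≤ 1 D λ {u} _ → row (R + u) 0 R ≤-refl)
               (≤-reflexive (∑<-cong D λ {u} _ → ∑<-cong D λ {v} _ → shift u v)) ⟩
        D * 1 + oppositePairs Q D ∎

    Q+Q≡R : Q + Q ≡ R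
    Q+Q≡R = cong (Q +_) (sym (+-identityʳ Q))

    farRow : ∀ u {D} → u < Q → D ≤ u + Q → D ≤ R → ∑< D (E u) ≡ 0
    farRow u {D} u<Q D≤u+Q D≤R = ∑<-zero D λ {v} v<D → ⟦⟧-false (_ ≟ _) λ eq →
      <⇒≢ (<-≤-trans v<D D≤u+Q) (sym (trans
        (sym (m<n⇒m%n≡m (<-≤-trans (+-monoˡ-< Q u<Q) (≤-reflexive Q+Q≡R))))
        (trans eq (m<n⇒m%n≡m (<-≤-trans v<D D≤R)))))

    -- For `D ≤ Q` all rows are empty. Otherwise `D = Q + e` and `Q = e + f`: the `f` middle rows
    -- are empty, the first and the last `e` rows hold at most one pair each, and `2 (e + f) · 2 e`
    -- falls short of `(2 e + f)²` by `f²`.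
    small : ∀ D → D ≤ R → R * oppositePairs Q D ≤ D * D
    small D D≤R with ≤-total D Q
    ... | inj₁ D≤Q = ≤-trans (≤-reflexive (trans (cong (R *_) zeroPairs) (*-zeroʳ R))) z≤n
      where
      zeroPairs : oppositePairs Q D ≡ 0
      zeroPairs = ∑<-zero D λ {u} u<D → farRow u (<-≤-trans u<D D≤Q) (≤-trans D≤Q (m≤n+m Q u)) D≤R
    ... | inj₂ Q≤D with m≤n⇒∃[o]m+o≡n Q≤D
    ...   | e , refl with m≤n⇒∃[o]m+o≡n (+-cancelˡ-≤ Q e Q (≤-trans D≤R (≤-reflexive (sym Q+Q≡R))))
    ...     | f , refl = begin
      R * (∑[ u < e + f + e ] ∑< D′ (E u))
        ≡⟨ cong (R *_) (trans (∑<-split (e + f) e rowSum) (cong (_+ (∑[ u < e ] rowSum (e + f + u))) (∑<-split e f rowSum))) ⟩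
      R * ((∑< e rowSum + (∑[ u < f ] rowSum (e + u))) + (∑[ u < e ] rowSum (e + f + u)))
        ≤⟨ *-monoʳ-≤ R (+-mono-≤ (+-mono-≤ (∑<-≤ 1 e λ {u} _ → row u 0 D′ D≤R)
             (≤-reflexive (∑<-zero f λ {u} u<f → farRow (e + u) (+-monoʳ-< e u<f)
               (≤-trans (≤-reflexive (+-comm (e + f) e)) (+-monoˡ-≤ (e + f) (m≤m+n e u))) D≤R)))
             (∑<-≤ 1 e λ {u} _ → row (e + f + u) 0 D′ D≤R)) ⟩
      R * ((e * 1 + 0) + e * 1)
        ≤⟨ m≤m+n _ (f * f) ⟩
      R * ((e * 1 + 0) + e * 1) + f * f
        ≡⟨ amgm e f ⟩
      (e + f + e) * (e + f + e) ∎
      where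
      open ≤-Reasoning
      D′ = e + f + e
      rowSum = λ u → ∑< D′ (E u)
      amgm : ∀ e f → 2 * (e + f) * ((e * 1 + 0) + e * 1) + f * f ≡ (e + f + e) * (e + f + e)
      amgm = solve-∀

  private
    bounded : ∀ q r → r ≤ R → R * oppositePairs Q (q * R + r) ≤ (q * R + r) * (q * R + r)
    bounded zero    r r≤R = small r r≤R
    bounded (suc q) r r≤R = subst (λ d → R * oppositePairs Q d ≤ d * d) (sym (+-assoc R (q * R) r))
      (large (q * R + r) (bounded q r r≤R))

  -- The pairs make up at most the average share `1 / (2 * Q)` of the square. This depends on the
  -- residue being half a period away from 0: the residue 0 would collect the whole diagonal.
  oppositePairs-bound : ∀ D → 2 * Q * oppositePairs Q D ≤ D * D
  oppositePairs-bound D = subst (λ d → R * oppositePairs Q d ≤ d * d)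
    (trans (+-comm _ (D % R)) (sym (m≡m%n+[m/n]*n D R)))
    (bounded (D / R) (D % R) (<⇒≤ (m%n<n D R)))

-- For two keys at difference `δ`, this counts the ways in which both fall into a window of length
-- `D`, one at place `u` and the other at `v`, over all odd multipliers `1 + 2 * i` below
-- `2 ^ suc k`.
collisions : (k Q K : ℕ) .{{_ : NonZero K}} → ℕ → ℕ → ℕ
collisions k Q K δ D = ∑[ u < D ] ∑[ v < D ] ∑[ i < 2 ^ k ] ⟦ (u + (1 + 2 * i) * δ * Q) % K ≟ v % K ⟧

-- Reduced modulo `2 * Q`, a collision makes `(u , v)` an opposite pair. An odd `δ` is invertible
-- modulo `2 ^ suc k`, so each such pair determines `i`.
collisions-odd : ∀ k Q K .{{_ : NonZero Q}} .{{_ : NonZero K}} → K ≡ 2 ^ suc k * Q →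
                 ∀ e D → 2 * Q * collisions k Q K (1 + 2 * e) D ≤ D * D
collisions-odd k Q K K≡ e D = ≤-trans (*-monoʳ-≤ (2 * Q) (∑<-mono D λ {u} _ → ∑<-mono D λ {v} _ → oneIndex u v))
  (oppositePairs-bound Q D)
  where
  instance
    2Q≢0 : NonZero (2 * Q)
    2Q≢0 = m*n≢0 2 Q
  δ = 1 + 2 * e

  2Q∣K : 2 * Q ∣ K
  2Q∣K = divides (2 ^ k) (trans K≡ (lemma (2 ^ k) Q))
    where
    lemma : ∀ p q → 2 * p * q ≡ p * (2 * q)
    lemma = solve-∀

  coarsen : ∀ u v i → (u + (1 + 2 * i) * δ * Q) % K ≡ v % K → (u + Q) % (2 * Q) ≡ v % (2 * Q)
  coarsen u v i eq = begin
    (u + Q) % (2 * Q)                                        ≡⟨ [m+kn]%n≡m%n (u + Q) (i + e + 2 * i * e) (2 * Q) ⟨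
    (u + Q + (i + e + 2 * i * e) * (2 * Q)) % (2 * Q)        ≡⟨ cong (_% (2 * Q)) (lemma u i e Q) ⟩
    (u + (1 + 2 * i) * δ * Q) % (2 * Q)                      ≡⟨ m∣n⇒o%n%m≡o%m (2 * Q) K _ 2Q∣K ⟨
    (u + (1 + 2 * i) * δ * Q) % K % (2 * Q)                  ≡⟨ cong (_% (2 * Q)) eq ⟩
    v % K % (2 * Q)                                          ≡⟨ m∣n⇒o%n%m≡o%m (2 * Q) K v 2Q∣K ⟩
    v % (2 * Q)                                              ∎
    where
    open ≡-Reasoning
    lemma : ∀ u i e q → u + q + (i + e + 2 * i * e) * (2 * q) ≡ u + (1 + 2 * i) * (1 + 2 * e) * q
    lemma = solve-∀

  ordered : ∀ {u v i j} → j < 2 ^ k → i ≤ j →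
            (u + (1 + 2 * i) * δ * Q) % K ≡ v % K → (u + (1 + 2 * j) * δ * Q) % K ≡ v % K → i ≡ j
  ordered {u} {v} {i} j<H i≤j p q with m≤n⇒∃[o]m+o≡n i≤j
  ... | zero  , refl = sym (+-identityʳ i)
  -- The two multiples differ by `2 * Q * (suc o * δ)`, and `K` is `2 * Q * 2 ^ k`. Hence `2 ^ k`
  -- divides `suc o`, which is at most `j` and so too small.
  ... | suc o , refl = contradiction
    (2^k∣m*odd⇒2^k∣m k (suc o) e (*-cancelˡ-∣ (2 * Q) (subst (_∣ 2 * Q * (suc o * δ)) (trans K≡ (reorder (2 ^ k) Q))
      (%-≡⇒∣ _ _ K (trans p (trans (sym q) (cong (_% K) (lemma u i (suc o) δ Q))))))))
    (>⇒∤ (≤-<-trans (m≤n+m (suc o) i) j<H))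
    where
    reorder : ∀ p q → 2 * p * q ≡ 2 * q * p
    reorder = solve-∀
    lemma : ∀ u i o d q → u + (1 + 2 * (i + o)) * d * q ≡ u + (1 + 2 * i) * d * q + 2 * q * (o * d)
    lemma = solve-∀

  oneIndex : ∀ u v → (∑[ i < 2 ^ k ] ⟦ (u + (1 + 2 * i) * δ * Q) % K ≟ v % K ⟧) ≤ ⟦ (u + Q) % (2 * Q) ≟ v % (2 * Q) ⟧
  oneIndex u v = helper ((u + Q) % (2 * Q) ≟ v % (2 * Q))
    where
    helper : ∀ d → (∑[ i < 2 ^ k ] ⟦ (u + (1 + 2 * i) * δ * Q) % K ≟ v % K ⟧) ≤ ⟦ d ⟧
    helper (yes _) = ∑<-atMostOne (λ i → (u + (1 + 2 * i) * δ * Q) % K ≟ v % K) (2 ^ k) λ {i} {j} i<H j<H p q →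
      [ (λ i≤j → ordered {u} {v} j<H i≤j p q) , (λ j≤i → sym (ordered {u} {v} i<H j≤i q p)) ]′ (≤-total i j)
    helper (no ≢)  = ≤-reflexive (∑<-zero (2 ^ k) λ {i} _ → ⟦⟧-false (_ ≟ _) (≢ ∘ coarsen u v i))

-- A factor 2 of δ moves into the scale Q; the summand then has half the period in i.
collisions-even : ∀ k Q K .{{_ : NonZero K}} → K ≡ 2 ^ suc (suc k) * Q →
                  ∀ δ D → collisions (suc k) Q K (2 * δ) D ≡ 2 * collisions k (2 * Q) K δ D
collisions-even k Q K K≡ δ D = begin
  (∑[ u < D ] ∑[ v < D ] ∑[ i < 2 ^ suc k ] C u v i)
    ≡⟨ ∑<-cong D (λ {u} _ → ∑<-cong D λ {v} _ → halve u v) ⟩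
  (∑[ u < D ] ∑[ v < D ] (2 * (∑[ i < 2 ^ k ] C′ u v i)))
    ≡⟨ ∑<-cong D (λ {u} _ → ∑<-*ˡ 2 (λ v → ∑[ i < 2 ^ k ] C′ u v i) D) ⟩
  (∑[ u < D ] (2 * (∑[ v < D ] ∑[ i < 2 ^ k ] C′ u v i)))
    ≡⟨ ∑<-*ˡ 2 (λ u → ∑[ v < D ] ∑[ i < 2 ^ k ] C′ u v i) D ⟩
  2 * collisions k (2 * Q) K δ D ∎
  where
  open ≡-Reasoning
  C C′ : ℕ → ℕ → ℕ → ℕ
  C u v i = ⟦ (u + (1 + 2 * i) * (2 * δ) * Q) % K ≟ v % K ⟧
  C′ u v i = ⟦ (u + (1 + 2 * i) * δ * (2 * Q)) % K ≟ v % K ⟧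
  same : ∀ u v i → C u v i ≡ C′ u v i
  same u v i = cong (λ z → ⟦ (u + z) % K ≟ v % K ⟧) (lemma (1 + 2 * i) δ Q)
    where
    lemma : ∀ a d q → a * (2 * d) * q ≡ a * d * (2 * q)
    lemma = solve-∀
  periodic : ∀ u v i → C u v (2 ^ k + i) ≡ C u v i
  periodic u v i = cong (λ z → ⟦ z ≟ v % K ⟧) (trans
    (cong (_% K) (trans (lemma u (2 ^ k) i δ Q) (cong (λ z → u + (1 + 2 * i) * (2 * δ) * Q + δ * z) (sym K≡))))
    ([m+kn]%n≡m%n _ δ K))
    where
    lemma : ∀ u p i d q → u + (1 + 2 * (p + i)) * (2 * d) * q ≡ u + (1 + 2 * i) * (2 * d) * q + d * (2 * (2 * p) * q)
    lemma = solve-∀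
  halve : ∀ u v → ∑< (2 ^ suc k) (C u v) ≡ 2 * ∑< (2 ^ k) (C′ u v)
  halve u v = begin
    ∑< (2 * 2 ^ k) (C u v)
      ≡⟨ cong (λ m → ∑< m (C u v)) (cong (2 ^ k +_) (+-identityʳ (2 ^ k))) ⟩
    ∑< (2 ^ k + 2 ^ k) (C u v)
      ≡⟨ ∑<-split (2 ^ k) (2 ^ k) (C u v) ⟩
    ∑< (2 ^ k) (C u v) + (∑[ i < 2 ^ k ] C u v (2 ^ k + i))
      ≡⟨ cong₂ _+_ (∑<-cong (2 ^ k) λ {i} _ → same u v i)
           (∑<-cong (2 ^ k) λ {i} _ → trans (periodic u v i) (same u v i)) ⟩
    ∑< (2 ^ k) (C′ u v) + ∑< (2 ^ k) (C′ u v)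
      ≡⟨ cong (∑< (2 ^ k) (C′ u v) +_) (+-identityʳ _) ⟨
    2 * ∑< (2 ^ k) (C′ u v) ∎

-- Induction on the factors 2 of `δ`: each doubles `Q` and lowers `k` by one while `K` stays fixed,
-- and the factor 2 gained in the count is absorbed by the doubled `Q`. As `2 ^ suc k` does not
-- divide `δ`, an odd number is reached before `k` runs out.
collisions-bound : ∀ k Q K .{{_ : NonZero Q}} .{{_ : NonZero K}} → K ≡ 2 ^ suc k * Q →
                   ∀ δ D → ¬ 2 ^ suc k ∣ δ → 2 * Q * collisions k Q K δ D ≤ D * D
collisions-bound k Q K K≡ δ D N∤δ with even⊎odd δ
collisions-bound k       Q K K≡ δ D N∤δ | inj₂ (e , refl) = collisions-odd k Q K K≡ e D
collisions-bound zero    Q K K≡ δ D N∤δ | inj₁ (e , refl) = contradiction (m∣m*n e) N∤δ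
collisions-bound (suc k) Q K K≡ δ D N∤δ | inj₁ (e , refl) = begin
  2 * Q * collisions (suc k) Q K (2 * e) D        ≡⟨ cong (2 * Q *_) (collisions-even k Q K K≡ e D) ⟩
  2 * Q * (2 * collisions k (2 * Q) K e D)        ≡⟨ double Q (collisions k (2 * Q) K e D) ⟩
  2 * (2 * Q) * collisions k (2 * Q) K e D        ≤⟨ collisions-bound k (2 * Q) K {{m*n≢0 2 Q}} (trans K≡ (assoc (2 ^ k) Q)) e D
                                                       (λ N∣e → N∤δ (*-monoʳ-∣ 2 N∣e)) ⟩
  D * D                                           ∎
  where
  open ≤-Reasoning
  double : ∀ q c → 2 * q * (2 * c) ≡ 2 * (2 * q) * c
  double = solve-∀
  assoc : ∀ p q → 2 * (2 * p) * q ≡ 2 * p * (2 * q)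
  assoc = solve-∀

-- Windows containing exactly one key

-- [m = 1] ≥ m − m (m − 1), without subtraction.
2m≤[m≡1]+m² : ∀ m → 2 * m ≤ ⟦ m ≟ 1 ⟧ + m * m
2m≤[m≡1]+m² 0             = z≤n
2m≤[m≡1]+m² 1             = ≤-refl
2m≤[m≡1]+m² (suc (suc m)) = *-monoˡ-≤ (2 + m) (s≤s (s≤s (z≤n {m})))

module Isolation (k : ℕ) (A : List (Fin (2 ^ suc k))) (unique : Unique A) {{_ : NonZero (length A)}} where

  n H N Q K : ℕ
  n = length A
  H = 2 ^ k
  N = 2 ^ suc k
  Q = 2 * n
  K = N * Q

  instance
    N≢0 : NonZero N
    N≢0 = m^n≢0 2 (suc k)
    Q≢0 : NonZero Q
    Q≢0 = m*n≢0 2 n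
    K≢0 : NonZero K
    K≢0 = m*n≢0 N Q

  N≤K : N ≤ K
  N≤K = m≤m*n N Q

  -- Not reduced modulo `K`, because two tests are made on it: its residue lies below `N` when the
  -- key is in the window, and it lies itself below `K` when the key is sampled.
  position : ℕ → ℕ → Fin N → ℕ
  position i τ x = mulMod (suc k) (1 + 2 * i) (toℕ x) * Q + τ

  hit? : ∀ i τ x → Dec (position i τ x % K < N)
  hit? i τ x = position i τ x % K <? N

  hits : ℕ → ℕ → ℕ
  hits i τ = ∑[ x ∈ A ] ⟦ hit? i τ x ⟧

  private
    Hit : ℕ → ℕ → Fin N → ℕ
    Hit i τ x = ⟦ hit? i τ x ⟧

    inside : ℕ → ℕ
    inside z = ⟦ z % K <? N ⟧

    inside-periodic : ∀ z → inside (z + K) ≡ inside z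
    inside-periodic z = cong (λ r → ⟦ r <? N ⟧) ([m+n]%n≡m%n z K)

    inside-small : ∀ {z} → z < K → inside z ≡ ⟦ z <? N ⟧
    inside-small z<K = cong (λ r → ⟦ r <? N ⟧) (m<n⇒m%n≡m z<K)

    ∑-inside : (f : ℕ → ℕ) → (∑[ z < K ] (inside z * f z)) ≡ ∑< N f
    ∑-inside f = trans (∑<-cong K λ {z} z<K → cong (_* f z) (inside-small z<K)) (∑<-restrict f N≤K)

    -- As `K` is `N * Q`, reducing modulo `N` before scaling by `Q` agrees with reducing modulo `K`
    -- afterwards. Without the inner reduction the position is linear in the key.
    Hit≡inside : ∀ i τ x → Hit i τ x ≡ inside ((1 + 2 * i) * toℕ x * Q + τ)
    Hit≡inside i τ x = cong (λ r → ⟦ r <? N ⟧) (begin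
      (ax % N * Q + τ) % K              ≡⟨ cong (λ z → (z + τ) % K) (m%n*o≡m*o%[n*o] ax N Q) ⟩
      (ax * Q % K + τ) % K              ≡⟨ %-distribˡ-+ (ax * Q % K) τ K ⟩
      (ax * Q % K % K + τ % K) % K      ≡⟨ cong (λ z → (z + τ % K) % K) (m%n%n≡m%n (ax * Q) K) ⟩
      (ax * Q % K + τ % K) % K          ≡⟨ %-distribˡ-+ (ax * Q) τ K ⟨
      (ax * Q + τ) % K                  ∎)
      where
      open ≡-Reasoning
      ax = (1 + 2 * i) * toℕ x

    ∑-Hit : ∀ i x → (∑[ τ < K ] Hit i τ x) ≡ N
    ∑-Hit i x = begin
      (∑[ τ < K ] Hit i τ x)              ≡⟨ ∑<-cong K (λ {τ} _ → Hit≡inside i τ x) ⟩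
      (∑[ τ < K ] inside (c + τ))         ≡⟨ ∑<-periodic K inside inside-periodic c ⟩
      ∑< K inside                         ≡⟨ ∑<-cong K (λ {z} _ → sym (*-identityʳ (inside z))) ⟩
      (∑[ z < K ] (inside z * 1))         ≡⟨ ∑-inside (λ _ → 1) ⟩
      (∑[ _ < N ] 1)                      ≡⟨ trans (∑<-const 1 N) (*-identityʳ N) ⟩
      N                                   ∎
      where
      open ≡-Reasoning
      c = (1 + 2 * i) * toℕ x * Q

    ∑∑-Hit : ∀ x → (∑[ i < H ] ∑[ τ < K ] Hit i τ x) ≡ H * N
    ∑∑-Hit x = trans (∑<-cong H λ {i} _ → ∑-Hit i x) (∑<-const N H)

    joint : Fin N → Fin N → ℕ
    joint x y = ∑[ i < H ] ∑[ τ < K ] (Hit i τ x * Hit i τ y)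

    joint-same : ∀ x y → joint x y ≤ H * N
    joint-same x y = ≤-trans
      (∑<-mono H λ {i} _ → ∑<-mono K λ {τ} _ → lemma (hit? i τ x) (hit? i τ y))
      (≤-reflexive (∑∑-Hit x))
      where
      lemma : ∀ {P P′ : Set} (d : Dec P) (e : Dec P′) → ⟦ d ⟧ * ⟦ e ⟧ ≤ ⟦ d ⟧
      lemma (no _)  _       = z≤n
      lemma (yes _) (yes _) = ≤-refl
      lemma (yes _) (no _)  = z≤n

    -- The place of `x` becomes the summation variable in place of the shift. Here `δ` is `y − x`
    -- modulo `N`; the summand `N` avoids truncated subtraction and changes positions by a multiple
    -- of `K` only.
    ∑-joint : ∀ i x y → let δ = toℕ y + (N ∸ toℕ x) in
              (∑[ τ < K ] (Hit i τ x * Hit i τ y)) ≡ (∑[ u < N ] inside (u + (1 + 2 * i) * δ * Q))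
    ∑-joint i x y = begin
      (∑[ τ < K ] (Hit i τ x * Hit i τ y))    ≡⟨ ∑<-cong K (λ {τ} _ → cong₂ _*_ (Hit≡inside i τ x) (other τ)) ⟩
      (∑[ τ < K ] F (a * toℕ x * Q + τ))      ≡⟨ ∑<-periodic K F F-periodic (a * toℕ x * Q) ⟩
      ∑< K F                                  ≡⟨ ∑-inside (λ u → inside (u + a * δ * Q)) ⟩
      (∑[ u < N ] inside (u + a * δ * Q))     ∎
      where
      open ≡-Reasoning
      a = 1 + 2 * i
      d = N ∸ toℕ x
      δ = toℕ y + d
      F : ℕ → ℕ
      F z = inside z * inside (z + a * δ * Q)
      F-periodic : ∀ z → F (z + K) ≡ F z
      F-periodic z = cong₂ _*_ (inside-periodic z)
        (trans (cong inside (swap z K (a * δ * Q))) (inside-periodic (z + a * δ * Q)))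
        where
        swap : ∀ x y z → x + y + z ≡ x + z + y
        swap = solve-∀
      other : ∀ τ → Hit i τ y ≡ inside (a * toℕ x * Q + τ + a * δ * Q)
      other τ = trans (Hit≡inside i τ y) (cong (λ r → ⟦ r <? N ⟧) (begin
        (a * toℕ y * Q + τ) % K                            ≡⟨ [m+kn]%n≡m%n (a * toℕ y * Q + τ) a K ⟨
        (a * toℕ y * Q + τ + a * (N * Q)) % K              ≡⟨ cong (λ z → (a * toℕ y * Q + τ + a * (z * Q)) % K)
                                                                (m+[n∸m]≡n (<⇒≤ (Fin.toℕ<n x))) ⟨
        (a * toℕ y * Q + τ + a * ((toℕ x + d) * Q)) % K    ≡⟨ cong (_% K) (lemma a (toℕ x) (toℕ y) d Q τ) ⟩
        (a * toℕ x * Q + τ + a * δ * Q) % K                ∎))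
        where
        lemma : ∀ a x y d q t → a * y * q + t + a * ((x + d) * q) ≡ a * x * q + t + a * (y + d) * q
        lemma = solve-∀

    inside≤∑ : ∀ z → inside z ≤ (∑[ v < N ] ⟦ z % K ≟ v % K ⟧)
    inside≤∑ z = helper (z % K <? N)
      where
      helper : (d : Dec (z % K < N)) → ⟦ d ⟧ ≤ (∑[ v < N ] ⟦ z % K ≟ v % K ⟧)
      helper (no _)  = z≤n
      helper (yes p) = ≤-trans (≤-reflexive (sym (⟦⟧-true (_ ≟ _) (sym (m%n%n≡m%n z K)))))
        (∑<-≥ (λ v → ⟦ z % K ≟ v % K ⟧) p)

    -- Since `N = 2 * H` and `K = N * Q`, the bound `N * N / (2 * Q)` equals `H * K * (N / K)²`, the
    -- value for two independent uniform positions.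
    joint-distinct : ∀ x y → x ≢ y → 2 * Q * joint x y ≤ N * N
    joint-distinct x y x≢y = ≤-trans (*-monoʳ-≤ (2 * Q) below)
      (collisions-bound k Q K refl δ N N∤δ)
      where
      open ≤-Reasoning
      δ = toℕ y + (N ∸ toℕ x)
      C : ℕ → ℕ → ℕ → ℕ
      C u v i = ⟦ (u + (1 + 2 * i) * δ * Q) % K ≟ v % K ⟧
      below : joint x y ≤ collisions k Q K δ N
      below = begin
        joint x y
          ≡⟨ ∑<-cong H (λ {i} _ → ∑-joint i x y) ⟩
        (∑[ i < H ] ∑[ u < N ] inside (u + (1 + 2 * i) * δ * Q))
          ≤⟨ ∑<-mono H (λ {i} _ → ∑<-mono N λ {u} _ → inside≤∑ (u + (1 + 2 * i) * δ * Q)) ⟩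
        (∑[ i < H ] ∑[ u < N ] ∑[ v < N ] C u v i)
          ≡⟨ ∑<-swap (λ i u → ∑[ v < N ] C u v i) H N ⟩
        (∑[ u < N ] ∑[ i < H ] ∑[ v < N ] C u v i)
          ≡⟨ ∑<-cong N (λ {u} _ → ∑<-swap (λ i v → C u v i) H N) ⟩
        collisions k Q K δ N ∎
      N∤δ : ¬ N ∣ δ
      N∤δ N∣δ = x≢y (Fin.toℕ-injective (sym (%-shift-injective (N ∸ toℕ x) N (Fin.toℕ<n y) (Fin.toℕ<n x) (begin-equality
        (N ∸ toℕ x + toℕ y) % N      ≡⟨ cong (_% N) (+-comm (N ∸ toℕ x) (toℕ y)) ⟩
        δ % N                        ≡⟨ n∣m⇒m%n≡0 δ N N∣δ ⟩
        0                            ≡⟨ n%n≡0 N ⟨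
        N % N                        ≡⟨ cong (_% N) (m∸n+n≡m (<⇒≤ (Fin.toℕ<n x))) ⟨
        (N ∸ toℕ x + toℕ x) % N      ∎))))

    joint-bound : ∀ x y → 2 * Q * joint x y ≤ 2 * Q * (H * N) * ⟦ x Fin.≟ y ⟧ + N * N
    joint-bound x y = helper (x Fin.≟ y)
      where
      helper : (d : Dec (x ≡ y)) → 2 * Q * joint x y ≤ 2 * Q * (H * N) * ⟦ d ⟧ + N * N
      helper (yes _)  = ≤-trans (*-monoʳ-≤ (2 * Q) (joint-same x y))
        (≤-trans (≤-reflexive (sym (*-identityʳ _))) (m≤m+n _ (N * N)))
      helper (no x≢y) = ≤-trans (joint-distinct x y x≢y) (m≤n+m (N * N) _)

  isolated : ℕ
  isolated = ∑[ i < H ] ∑[ τ < K ] ⟦ hits i τ ≟ 1 ⟧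

  private
    Z S₂ : ℕ
    Z  = n * (H * N)
    S₂ = ∑[ i < H ] ∑[ τ < K ] (hits i τ * hits i τ)

    first-moment : (∑[ i < H ] ∑[ τ < K ] hits i τ) ≡ Z
    first-moment = begin
      (∑[ i < H ] ∑[ τ < K ] hits i τ)                      ≡⟨ ∑-push Hit A H K ⟩
      (∑[ x ∈ A ] ∑[ i < H ] ∑[ τ < K ] Hit i τ x)          ≡⟨ ∑-cong A (λ {x} _ → ∑∑-Hit x) ⟩
      (∑[ _ ∈ A ] (H * N))                                  ≡⟨ ∑-const (H * N) A ⟩
      Z                                                     ∎
      where open ≡-Reasoning

    -- The diagonal contributes at most `Z`. The independent bound `N * N / (2 * Q)`, granted to all
    -- `n * n` pairs, adds `Z / 2`, because `Q = 2 * n` and `N = 2 * H`.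
    second-moment : 2 * S₂ ≤ 3 * Z
    second-moment = *-cancelˡ-≤ Q (begin
      Q * (2 * S₂)
        ≡⟨ reorder Q S₂ ⟩
      2 * Q * S₂
        ≡⟨ cong (2 * Q *_) (begin-equality
             S₂
               ≡⟨ ∑<-cong H (λ {i} _ → ∑<-cong K λ {τ} _ → ∑-*-∑ (Hit i τ) (Hit i τ) A A) ⟩
             (∑[ i < H ] ∑[ τ < K ] ∑[ x ∈ A ] ∑[ y ∈ A ] (Hit i τ x * Hit i τ y))
               ≡⟨ ∑-push (λ i τ x → ∑[ y ∈ A ] (Hit i τ x * Hit i τ y)) A H K ⟩
             (∑[ x ∈ A ] ∑[ i < H ] ∑[ τ < K ] ∑[ y ∈ A ] (Hit i τ x * Hit i τ y))
               ≡⟨ ∑-cong A (λ {x} _ → ∑-push (λ i τ y → Hit i τ x * Hit i τ y) A H K) ⟩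
             (∑[ x ∈ A ] ∑[ y ∈ A ] joint x y) ∎) ⟩
      2 * Q * (∑[ x ∈ A ] ∑[ y ∈ A ] joint x y)
        ≡⟨ ∑-*ˡ (2 * Q) (λ x → ∑ A (joint x)) A ⟨
      (∑[ x ∈ A ] (2 * Q * (∑[ y ∈ A ] joint x y)))
        ≤⟨ ∑-mono A (λ {x} _ → row x) ⟩
      (∑[ _ ∈ A ] (2 * Q * (H * N) + n * (N * N)))
        ≡⟨ ∑-const (2 * Q * (H * N) + n * (N * N)) A ⟩
      n * (2 * Q * (H * N) + n * (N * N))
        ≡⟨ collect n H ⟩
      Q * (3 * Z) ∎)
      where
      open ≤-Reasoning
      reorder : ∀ q s → q * (2 * s) ≡ 2 * q * s
      reorder = solve-∀
      collect : ∀ n h → n * (2 * (2 * n) * (h * (2 * h)) + n * (2 * h * (2 * h))) ≡ 2 * n * (3 * (n * (h * (2 * h))))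
      collect = solve-∀
      row : ∀ x → 2 * Q * (∑[ y ∈ A ] joint x y) ≤ 2 * Q * (H * N) + n * (N * N)
      row x = begin
        2 * Q * (∑[ y ∈ A ] joint x y)
          ≡⟨ ∑-*ˡ (2 * Q) (joint x) A ⟨
        (∑[ y ∈ A ] (2 * Q * joint x y))
          ≤⟨ ∑-mono A (λ {y} _ → joint-bound x y) ⟩
        (∑[ y ∈ A ] (2 * Q * (H * N) * ⟦ x Fin.≟ y ⟧ + N * N))
          ≡⟨ ∑-+ (λ y → 2 * Q * (H * N) * ⟦ x Fin.≟ y ⟧) (λ _ → N * N) A ⟩
        (∑[ y ∈ A ] (2 * Q * (H * N) * ⟦ x Fin.≟ y ⟧)) + (∑[ _ ∈ A ] (N * N))
          ≡⟨ cong₂ _+_ (∑-*ˡ (2 * Q * (H * N)) (λ y → ⟦ x Fin.≟ y ⟧) A) (∑-const (N * N) A) ⟩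
        2 * Q * (H * N) * (∑[ y ∈ A ] ⟦ x Fin.≟ y ⟧) + n * (N * N)
          ≤⟨ +-monoˡ-≤ (n * (N * N)) (*-monoʳ-≤ (2 * Q * (H * N))
               (∑-atMostOne (x Fin.≟_) unique λ _ _ p q → trans (sym p) q)) ⟩
        2 * Q * (H * N) * 1 + n * (N * N)
          ≡⟨ cong (_+ n * (N * N)) (*-identityʳ (2 * Q * (H * N))) ⟩
        2 * Q * (H * N) + n * (N * N) ∎

  -- The two moments give at least `2 Z − 3 Z / 2 = Z / 2` isolated pairs, a quarter of all
  -- `H * K = 2 * Z` pairs of multiplier and shift. Adding `3 * Z` on both sides avoids subtraction.
  isolated-bound : n * (H * N) ≤ 2 * isolated
  isolated-bound = +-cancelʳ-≤ (3 * Z) Z (2 * isolated) (begin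
    Z + 3 * Z                       ≡⟨ quadruple Z ⟩
    2 * (2 * Z)                     ≡⟨ cong (λ z → 2 * (2 * z)) first-moment ⟨
    2 * (2 * (∑[ i < H ] ∑[ τ < K ] hits i τ))
      ≡⟨ cong (2 *_) (trans (∑<-cong H λ {i} _ → ∑<-*ˡ 2 (hits i) K) (∑<-*ˡ 2 (λ i → ∑< K (hits i)) H)) ⟨
    2 * (∑[ i < H ] ∑[ τ < K ] (2 * hits i τ))
      ≤⟨ *-monoʳ-≤ 2 (∑<-mono H λ {i} _ → ∑<-mono K λ {τ} _ → 2m≤[m≡1]+m² (hits i τ)) ⟩
    2 * (∑[ i < H ] ∑[ τ < K ] (⟦ hits i τ ≟ 1 ⟧ + hits i τ * hits i τ))
      ≡⟨ cong (2 *_) (trans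
           (∑<-cong H λ {i} _ → ∑<-+ (λ τ → ⟦ hits i τ ≟ 1 ⟧) (λ τ → hits i τ * hits i τ) K)
           (∑<-+ (λ i → ∑[ τ < K ] ⟦ hits i τ ≟ 1 ⟧) (λ i → ∑[ τ < K ] (hits i τ * hits i τ)) H)) ⟩
    2 * (isolated + S₂)             ≡⟨ *-distribˡ-+ 2 isolated S₂ ⟩
    2 * isolated + 2 * S₂           ≤⟨ +-monoʳ-≤ (2 * isolated) second-moment ⟩
    2 * isolated + 3 * Z            ∎)
    where
    open ≤-Reasoning
    quadruple : ∀ z → z + 3 * z ≡ 2 * (2 * z)
    quadruple = solve-∀

-- Sampled sums in a commutative monoid

module PartialSum {c ℓ} (R : CommutativeMonoid c ℓ) {x} {X : Set x} (v : X → CommutativeMonoid.Carrier R) where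

  open CommutativeMonoid R renaming (refl to ≈-refl; sym to ≈-sym; trans to ≈-trans)
  open import Algebra.Properties.CommutativeSemigroup commutativeSemigroup using (x∙yz≈y∙xz)

  -- The same fold as in `sampledSum`, which therefore unfolds to an instance of it.
  partialSum : List X → (X → Bool) → Carrier
  partialSum xs p = foldr (λ x acc → if p x then v x ∙ acc else acc) ε xs

  partialSum-cong : ∀ xs {p q} → (∀ x → p x ≡ q x) → partialSum xs p ≡ partialSum xs q
  partialSum-cong []       _ = refl
  partialSum-cong (x ∷ xs) h = cong₂ (λ b acc → if b then v x ∙ acc else acc) (h x) (partialSum-cong xs h)

  -- The equation between indicators says that `p` is the disjoint union of `q` and `r` on `xs`, and
  -- rules out all other combinations of truth values by computation.
  partialSum-disjoint : ∀ xs {p q r} → (∀ {x} → x ∈ xs → 𝟙 (p x) ≡ 𝟙 (q x) + 𝟙 (r x)) →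
                        partialSum xs p ≈ partialSum xs q ∙ partialSum xs r
  partialSum-disjoint []       _ = ≈-sym (identityˡ ε)
  partialSum-disjoint (x ∷ xs) {p} {q} {r} h
    with p x | q x | r x | h (here refl) | partialSum-disjoint xs {p} {q} {r} (h ∘ there)
  ... | false | false | false | _ | ih = ih
  ... | true  | true  | false | _ | ih = ≈-trans (∙-congˡ ih) (≈-sym (assoc _ _ _))
  ... | true  | false | true  | _ | ih = ≈-trans (∙-congˡ ih) (x∙yz≈y∙xz _ _ _)

  partialSum-support : (v≈ε? : ∀ x → Dec (v x ≈ ε)) → ∀ xs p →
                       partialSum xs p ≈ partialSum (filter (¬? ∘ v≈ε?) xs) p
  partialSum-support v≈ε? []       p = ≈-refl
  partialSum-support v≈ε? (x ∷ xs) p with v≈ε? x | p x in eq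
  ... | no  _ | true  rewrite eq = ∙-congˡ (partialSum-support v≈ε? xs p)
  ... | no  _ | false rewrite eq = partialSum-support v≈ε? xs p
  ... | yes h | true  = ≈-trans (∙-cong h (partialSum-support v≈ε? xs p)) (identityˡ _)
  ... | yes _ | false = partialSum-support v≈ε? xs p

  partialSum-none : ∀ xs p → (∑[ x ∈ xs ] 𝟙 (p x)) ≡ 0 → partialSum xs p ≈ ε
  partialSum-none []       p _ = ≈-refl
  partialSum-none (x ∷ xs) p h with p x
  ... | false = partialSum-none xs p h

  partialSum-one : ∀ {xs} → All (λ x → ¬ v x ≈ ε) xs → ∀ p → (∑[ x ∈ xs ] 𝟙 (p x)) ≡ 1 → ¬ partialSum xs p ≈ ε
  partialSum-one {x ∷ xs} (vx≉ε ∷ v≉ε) p h eq with p x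
  ... | false = partialSum-one v≉ε p h eq
  ... | true  = vx≉ε (≈-trans (≈-sym (≈-trans (∙-congˡ (partialSum-none xs p (suc-injective h))) (identityʳ (v x)))) eq)

-- Windows as differences of prefixes

module _ {N K : ℕ} .{{_ : NonZero K}} (N≤K : N ≤ K) where

  private
    above% : ∀ z → K ≤ z → z < K + K → z % K ≡ z ∸ K
    above% z K≤z z<2K = trans (sym (m≤n⇒[n∸m]%m≡n%m K≤z))
      (m<n⇒m%n≡m (+-cancelˡ-< K _ _ (≤-<-trans (≤-reflexive (m+[n∸m]≡n K≤z)) z<2K)))

    below-∸ : ∀ {z} → K ≤ z → z < K + N → z ∸ K < N
    below-∸ K≤z z<K+N = +-cancelˡ-< K _ _ (≤-<-trans (≤-reflexive (m+[n∸m]≡n K≤z)) z<K+N)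

  -- Let `z = y + N`. Below `K`, `z` is its own residue and at least `N`; from `K` on, its residue
  -- is `z ∸ K`, which is below `N` exactly when `y < K`.
  window-above : ∀ y → y + N < K + K → ⟦ y <? K ⟧ ≡ ⟦ y + N <? K ⟧ + ⟦ (y + N) % K <? N ⟧
  window-above y z<2K with y + N <? K
  ... | yes z<K = trans (⟦⟧-true (y <? K) (≤-<-trans (m≤m+n y N) z<K)) (sym (cong₂ _+_ (⟦⟧-true (y + N <? K) z<K)
          (⟦⟧-false ((y + N) % K <? N) λ h → m+n≮n y N (subst (_< N) (m<n⇒m%n≡m z<K) h))))
  ... | no  z≮K = trans (⟦⟧-cong (y <? K) ((y + N) % K <? N)
          (λ y<K → subst (_< N) (sym (above% (y + N) K≤z z<2K)) (below-∸ K≤z (+-monoˡ-< N y<K)))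
          (λ h → +-cancelʳ-< N y K (subst (_< K + N) (m+[n∸m]≡n K≤z)
            (+-monoʳ-< K (subst (_< N) (above% (y + N) K≤z z<2K) h)))))
          (cong (_+ ⟦ (y + N) % K <? N ⟧) (sym (⟦⟧-false (y + N <? K) z≮K)))
    where K≤z = ≮⇒≥ z≮K

  -- The window that wraps around is a prefix for the shift increased by `K ∸ N`, together with
  -- everything that has passed `K`: there the residue `z ∸ K` is always below `N`.
  window-around : ∀ z → z < K + N → ⟦ z % K <? N ⟧ ≡ ⟦ z + (K ∸ N) <? K ⟧ + 𝟙 (not (does (z <? K)))
  window-around z z<K+N = helper (z <? K)
    where
    K∸N+N = m∸n+n≡m N≤K
    helper : (d : Dec (z < K)) → ⟦ z % K <? N ⟧ ≡ ⟦ z + (K ∸ N) <? K ⟧ + 𝟙 (not (does d))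
    helper (yes z<K) = trans (⟦⟧-cong (z % K <? N) (z + (K ∸ N) <? K)
      (λ h → subst (z + (K ∸ N) <_) (m+[n∸m]≡n N≤K) (+-monoˡ-< (K ∸ N) (subst (_< N) (m<n⇒m%n≡m z<K) h)))
      (λ h → subst (_< N) (sym (m<n⇒m%n≡m z<K)) (+-cancelʳ-< (K ∸ N) z N (subst (z + (K ∸ N) <_) (sym (m+[n∸m]≡n N≤K)) h))))
      (sym (+-identityʳ _))
    helper (no z≮K)  = trans
      (⟦⟧-true (z % K <? N) (subst (_< N) (sym (above% z K≤z (<-≤-trans z<K+N (+-monoʳ-≤ K N≤K)))) (below-∸ K≤z z<K+N)))
      (sym (cong (_+ 1) (⟦⟧-false (z + (K ∸ N) <? K) λ h → z≮K (≤-<-trans (m≤m+n z (K ∸ N)) h))))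
      where K≤z = ≮⇒≥ z≮K

-- Counting good outcomes

m/o<n⇒m<n*o : ∀ m n o .{{_ : NonZero o}} → m / o < n → m < n * o
m/o<n⇒m<n*o m n o m/o<n = begin-strict
  m                        ≡⟨ m≡m%n+[m/n]*n m o ⟩
  m % o + m / o * o        <⟨ +-monoˡ-< (m / o * o) (m%n<n m o) ⟩
  suc (m / o) * o          ≤⟨ *-monoˡ-≤ o m/o<n ⟩
  n * o                    ∎
  where open ≤-Reasoning

-- The decisions `v≈ε?` and `good?` are parameters here; they become available under the double
-- negation of the final statement.
module Counting {c ℓ} (R : CommutativeMonoid c ℓ) (k : ℕ) (v : Fin (2 ^ suc k) → CommutativeMonoid.Carrier R)
  (v≈ε? : ∀ x → Dec (CommutativeMonoid._≈_ R (v x) (CommutativeMonoid.ε R)))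
  (x₀ : Fin (2 ^ suc k)) (vx₀≉ε : ¬ CommutativeMonoid._≈_ R (v x₀) (CommutativeMonoid.ε R))
  (good? : ∀ o → Dec (GoodOutcome R (suc k) v o)) where

  open CommutativeMonoid R hiding (refl; sym; trans)
  open CommutativeMonoid R using () renaming (sym to ≈-sym; trans to ≈-trans)
  open PartialSum R v

  support : List (Fin (2 ^ suc k))
  support = filter (¬? ∘ v≈ε?) (allFin (2 ^ suc k))

  support-nonempty : NonZero (length support)
  support-nonempty = helper (∈-filter⁺ (¬? ∘ v≈ε?) (∈-allFin x₀) vx₀≉ε)
    where
    helper : ∀ {xs} → x₀ ∈ xs → NonZero (length xs)
    helper (here _)  = _
    helper (there _) = _

  support-nonzero : All (λ x → ¬ v x ≈ ε) support
  support-nonzero = all-filter (¬? ∘ v≈ε?) (allFin _)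

  open Isolation k support (filter⁺ (¬? ∘ v≈ε?) (allFin⁺ _)) {{support-nonempty}}

  hash : ℕ → Fin N → ℕ
  hash i x = mulMod (suc k) (1 + 2 * i) (toℕ x)

  hash<N : ∀ i x → hash i x < N
  hash<N i x = m%n<n ((1 + 2 * i) * toℕ x) N

  -- The shift runs downwards: a larger τ means a smaller sampling threshold.
  threshold : ℕ → ℕ
  threshold τ = N ∸ suc (τ / Q)

  below? : ∀ i τ x → Dec (position i τ x < K)
  below? i τ x = position i τ x <? K

  below : ℕ → ℕ → Fin N → Bool
  below i τ x = does (below? i τ x)

  position-bound : ∀ i τ x → position i τ x < K + τ
  position-bound i τ x = +-monoˡ-< τ (*-monoˡ-< Q (hash<N i x))

  -- `h * Q + τ < N * Q` holds exactly when `h + τ / Q < N`, that is, when `h ≤ N ∸ suc (τ / Q)`.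
  sample≡below : ∀ i {τ} → τ < K → ∀ x → sample (suc k) (1 + 2 * i) (threshold τ) x ≡ below i τ x
  sample≡below i {τ} τ<K x = does-⇔ (mk⇔ to from) (h ≤? threshold τ) (below? i τ x)
    where
    h = hash i x
    s<N : τ / Q < N
    s<N = m<n*o⇒m/o<n τ<K
    quotient≡ : (h * Q + τ) / Q ≡ h + τ / Q
    quotient≡ = trans (+-distrib-/-∣ˡ τ (n∣m*n h)) (cong (_+ τ / Q) (m*n/n≡m h Q))
    to : h ≤ threshold τ → h * Q + τ < K
    to h≤t = m/o<n⇒m<n*o (h * Q + τ) N Q (subst (_< N) (sym quotient≡)
      (≤-trans (≤-reflexive (sym (+-suc h (τ / Q))))
        (≤-trans (+-monoˡ-≤ (suc (τ / Q)) h≤t) (≤-reflexive (m∸n+n≡m s<N)))))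
    from : h * Q + τ < K → h ≤ threshold τ
    from z<K = m+n≤o⇒m≤o∸n h (≤-trans (≤-reflexive (+-suc h (τ / Q)))
      (subst (_< N) quotient≡ (m<n*o⇒m/o<n z<K)))

  -- This is `τ − N` modulo `K`, the shift belonging to the other end of the window.
  shifted : ℕ → ℕ
  shifted τ = (K ∸ N + τ) % K

  all : Fin N → Bool
  all _ = true

  -- The prefix at `τ − N` is the disjoint union of the prefix at `τ` and the window. If both
  -- prefixes sum to `ε`, so does the window, although it contains a single nonzero value.
  isolated⇒¬both-zero-above : ∀ i {τ} → N ≤ τ → τ < K → hits i τ ≡ 1 →
    partialSum support (below i τ) ≈ ε → ¬ partialSum support (below i (shifted τ)) ≈ ε
  isolated⇒¬both-zero-above i N≤τ τ<K one here≈ε there≈ε with m≤n⇒∃[o]m+o≡n N≤τ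
  ... | y , refl = partialSum-one support-nonzero (does ∘ hit? i (N + y)) one
    (≈-trans (≈-sym (≈-trans (∙-congʳ here≈ε) (identityˡ _)))
      (≈-trans (≈-sym (partialSum-disjoint support {below i y} {below i (N + y)} λ {x} _ → split x))
        (subst (λ σ → partialSum support (below i σ) ≈ ε) shifted≡y there≈ε)))
    where
    open ≡-Reasoning
    shifted≡y : shifted (N + y) ≡ y
    shifted≡y = begin
      (K ∸ N + (N + y)) % K      ≡⟨ cong (_% K) (+-assoc (K ∸ N) N y) ⟨
      (K ∸ N + N + y) % K        ≡⟨ cong (λ z → (z + y) % K) (m∸n+n≡m N≤K) ⟩
      (K + y) % K                ≡⟨ cong (_% K) (+-comm K y) ⟩
      (y + K) % K                ≡⟨ [m+n]%n≡m%n y K ⟩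
      y % K                      ≡⟨ m<n⇒m%n≡m (≤-<-trans (m≤n+m y N) τ<K) ⟩
      y                          ∎
    split : ∀ x → ⟦ below? i y x ⟧ ≡ ⟦ below? i (N + y) x ⟧ + ⟦ hit? i (N + y) x ⟧
    split x = subst (λ z → ⟦ below? i y x ⟧ ≡ ⟦ z <? K ⟧ + ⟦ z % K <? N ⟧) position≡
      (window-above N≤K (position i y x) (subst (_< K + K) (sym position≡)
        (<-trans (position-bound i (N + y) x) (+-monoʳ-< K τ<K))))
      where
      position≡ : position i y x + N ≡ position i (N + y) x
      position≡ = trans (+-assoc (hash i x * Q) y N) (cong (hash i x * Q +_) (+-comm y N))

  -- The window now is the prefix `low` at the other end together with the complement `high` of the
  -- prefix at `τ`, so the contradiction requires `high` to sum to `ε`.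
  isolated⇒¬both-zero-around : ∀ i {τ} → τ < N → hits i τ ≡ 1 →
    partialSum support all ≈ ε ⊎ Any (λ x → toℕ x ≡ 0) support →
    partialSum support (below i τ) ≈ ε → ¬ partialSum support (below i (shifted τ)) ≈ ε
  isolated⇒¬both-zero-around i {τ} τ<N one total≈ε⊎0∈ here≈ε there≈ε =
    partialSum-one support-nonzero (does ∘ hit? i τ) one
      (≈-trans (partialSum-disjoint support {does ∘ hit? i τ} {low} {high} λ {x} _ → split x)
        (≈-trans (∙-cong (subst (λ σ → partialSum support (below i σ) ≈ ε) shifted≡ there≈ε) (high≈ε total≈ε⊎0∈)) (identityˡ ε)))
    where
    K∸N+τ<K : K ∸ N + τ < K
    K∸N+τ<K = subst (K ∸ N + τ <_) (m∸n+n≡m N≤K) (+-monoʳ-< (K ∸ N) τ<N)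
    shifted≡ : shifted τ ≡ K ∸ N + τ
    shifted≡ = m<n⇒m%n≡m K∸N+τ<K
    low high : Fin N → Bool
    low = below i (K ∸ N + τ)
    high = not ∘ below i τ
    split : ∀ x → ⟦ hit? i τ x ⟧ ≡ 𝟙 (low x) + 𝟙 (high x)
    split x = subst (λ z → ⟦ hit? i τ x ⟧ ≡ ⟦ z <? K ⟧ + 𝟙 (high x))
      (trans (+-assoc (hash i x * Q) τ (K ∸ N)) (cong (hash i x * Q +_) (+-comm τ (K ∸ N))))
      (window-around N≤K (position i τ x) (<-trans (position-bound i τ x) (+-monoʳ-< K τ<N)))
    complement : ∀ b → 1 ≡ 𝟙 b + 𝟙 (not b)
    complement true  = refl
    complement false = refl
    high≈ε : partialSum support all ≈ ε ⊎ Any (λ x → toℕ x ≡ 0) support → partialSum support high ≈ ε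
    high≈ε (inj₁ total≈ε) = ≈-trans (≈-sym (≈-trans (∙-congʳ here≈ε) (identityˡ _)))
      (≈-trans (≈-sym (partialSum-disjoint support {all} {below i τ} {high} λ {x} _ → complement (below i τ x))) total≈ε)
    -- The key 0 hashes to 0 under every multiplier and thus lies in `low`. It uses up the only hit,
    -- and `high` is empty.
    high≈ε (inj₂ 0∈) with find 0∈
    ... | z , z∈ , z≡0 = partialSum-none support high (n≤0⇒n≡0 (+-cancelˡ-≤ 1 _ 0 (begin
      1 + ∑ support (𝟙 ∘ high)
        ≡⟨ cong (_+ ∑ support (𝟙 ∘ high)) (⟦⟧-true (below? i (K ∸ N + τ) z) z-low) ⟨
      𝟙 (low z) + ∑ support (𝟙 ∘ high)
        ≤⟨ +-monoˡ-≤ _ (∑-≥ (𝟙 ∘ low) z∈) ⟩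
      ∑ support (𝟙 ∘ low) + ∑ support (𝟙 ∘ high)
        ≡⟨ ∑-+ (𝟙 ∘ low) (𝟙 ∘ high) support ⟨
      (∑[ x ∈ support ] (𝟙 (low x) + 𝟙 (high x)))
        ≡⟨ ∑-cong support (λ {x} _ → split x) ⟨
      hits i τ
        ≡⟨ one ⟩
      1 ∎)))
      where
      open ≤-Reasoning
      hash≡0 : hash i z ≡ 0
      hash≡0 = begin-equality
        (1 + 2 * i) * toℕ z % N      ≡⟨ cong (λ y → (1 + 2 * i) * y % N) z≡0 ⟩
        (1 + 2 * i) * 0 % N          ≡⟨ cong (_% N) (*-zeroʳ (1 + 2 * i)) ⟩
        0 % N                        ≡⟨ m<n⇒m%n≡m (m^n>0 2 (suc k)) ⟩
        0                            ∎
      z-low : position i (K ∸ N + τ) z < K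
      z-low = subst (λ h → h * Q + (K ∸ N + τ) < K) (sym hash≡0) K∸N+τ<K

  good : ℕ → ℕ → ℕ
  good i t = ⟦ good? (1 + 2 * i , t) ⟧

  goods : ℕ
  goods = ∑[ i < H ] ∑[ t < N ] good i t

  odd<N : ∀ {i} → i < H → 1 + 2 * i < N
  odd<N {i} i<H = ≤-trans (≤-reflexive (lemma i)) (*-monoʳ-≤ 2 i<H)
    where
    lemma : ∀ i → suc (1 + 2 * i) ≡ 2 * suc i
    lemma = solve-∀

  odd%2 : ∀ i → (1 + 2 * i) % 2 ≡ 1
  odd%2 i = trans (cong (λ z → (1 + z) % 2) (*-comm 2 i)) ([m+kn]%n≡m%n 1 i 2)

  -- Equality in `R` may be undecidable, so failing to be good only refutes that the sum is nonzero.
  ¬good⇒zero : ∀ {i t} → i < H → t < N → ¬ GoodOutcome R (suc k) v (1 + 2 * i , t) →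
               ¬ ¬ partialSum support (sample (suc k) (1 + 2 * i) t) ≈ ε
  ¬good⇒zero {i} i<H t<N ¬good ≉ε = ¬good (odd<N i<H , odd%2 i , t<N ,
    λ sum≈ε → ≉ε (≈-trans (≈-sym (partialSum-support v≈ε? (allFin N) _)) sum≈ε))

  goodAt : ℕ → ℕ → ℕ
  goodAt i τ = good i (threshold τ)

  threshold<N : ∀ {τ} → τ < K → threshold τ < N
  threshold<N τ<K = ∸-monoʳ-< z<s (m<n*o⇒m/o<n τ<K)

  isolated≤good : partialSum support all ≈ ε ⊎ Any (λ x → toℕ x ≡ 0) support →
                  ∀ {i τ} → i < H → τ < K → ⟦ hits i τ ≟ 1 ⟧ ≤ goodAt i τ + goodAt i (shifted τ)
  isolated≤good assumption {i} {τ} i<H τ<K = ⟦⟧≤+ (hits i τ ≟ 1) (good? _) (good? _) λ one ¬good ¬good′ →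
    zeroAt τ<K ¬good λ here≈ε → zeroAt (m%n<n _ K) ¬good′ λ there≈ε →
      [ (λ τ<N → isolated⇒¬both-zero-around i τ<N one assumption here≈ε there≈ε)
      , (λ N≤τ → isolated⇒¬both-zero-above i N≤τ τ<K one here≈ε there≈ε) ]′ (<-≤-connex τ N)
    where
    zeroAt : ∀ {σ} → σ < K → ¬ GoodOutcome R (suc k) v (1 + 2 * i , threshold σ) →
             ¬ ¬ partialSum support (below i σ) ≈ ε
    zeroAt {σ} σ<K ¬good ≉ε = ¬good⇒zero i<H (threshold<N σ<K) ¬good λ sum≈ε →
      ≉ε (subst (_≈ ε) (partialSum-cong support (sample≡below i σ<K)) sum≈ε)

  ∑-goodAt : ∀ i → ∑< K (goodAt i) ≡ Q * ∑< N (good i)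
  ∑-goodAt i = trans (∑<-blocks Q N (λ s → good i (N ∸ suc s))) (cong (Q *_) (∑<-reverse N (good i)))

  ∑-goodAt-shifted : ∀ i → (∑[ τ < K ] goodAt i (shifted τ)) ≡ Q * ∑< N (good i)
  ∑-goodAt-shifted i = begin
    (∑[ τ < K ] goodAt i ((K ∸ N + τ) % K))
      ≡⟨ ∑<-periodic K (λ z → goodAt i (z % K)) (λ z → cong (goodAt i) ([m+n]%n≡m%n z K)) (K ∸ N) ⟩
    (∑[ τ < K ] goodAt i (τ % K))
      ≡⟨ ∑<-cong K (λ τ<K → cong (goodAt i) (m<n⇒m%n≡m τ<K)) ⟩
    ∑< K (goodAt i)
      ≡⟨ ∑-goodAt i ⟩
    Q * ∑< N (good i) ∎
    where open ≡-Reasoning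

  -- Each isolated window is charged to a good end. Every threshold comes from `Q` shifts and every
  -- shift is an end of two windows, so `n * (H * N) ≤ 2 * isolated ≤ 4 * Q * goods`, and `Q = 2 *
  -- n`.
  goods-bound-isolated : partialSum support all ≈ ε ⊎ Any (λ x → toℕ x ≡ 0) support → H * N ≤ 8 * goods
  goods-bound-isolated assumption = *-cancelˡ-≤ n {{support-nonempty}} (begin
    n * (H * N)
      ≤⟨ isolated-bound ⟩
    2 * isolated
      ≤⟨ *-monoʳ-≤ 2 (∑<-mono H λ {i} i<H → ∑<-mono K λ {τ} τ<K → isolated≤good assumption i<H τ<K) ⟩
    2 * (∑[ i < H ] ∑[ τ < K ] (goodAt i τ + goodAt i (shifted τ)))
      ≡⟨ cong (2 *_) (∑<-cong H λ {i} _ → trans (∑<-+ (goodAt i) (goodAt i ∘ shifted) K)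
           (cong₂ _+_ (∑-goodAt i) (∑-goodAt-shifted i))) ⟩
    2 * (∑[ i < H ] (Q * ∑< N (good i) + Q * ∑< N (good i)))
      ≡⟨ cong (2 *_) (trans (∑<-+ (λ i → Q * ∑< N (good i)) (λ i → Q * ∑< N (good i)) H)
           (cong₂ _+_ (∑<-*ˡ Q (λ i → ∑< N (good i)) H) (∑<-*ˡ Q (λ i → ∑< N (good i)) H))) ⟩
    2 * (Q * goods + Q * goods)
      ≡⟨ lemma n goods ⟩
    n * (8 * goods) ∎)
    where
    open ≤-Reasoning
    lemma : ∀ n g → 2 * (2 * n * g + 2 * n * g) ≡ n * (8 * g)
    lemma = solve-∀

  -- The index `H ∸ suc i` belongs to the multiplier `N − a`. The two hashes add up to a multiple of
  -- `N` below `2 * N`, and it is positive because an odd multiplier sends no nonzero key to 0.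
  hash-negate : ∀ {i} x → i < H → toℕ x ≢ 0 → hash i x + hash (H ∸ suc i) x ≡ N
  hash-negate {i} x i<H x≢0 = exact (m%n≡0⇒n∣m _ N sum%N≡0)
    where
    open ≤-Reasoning
    j = H ∸ suc i
    a = 1 + 2 * i
    b = 1 + 2 * j
    a+b≡N : a + b ≡ N
    a+b≡N = trans (lemma i j) (cong (2 *_) (m+[n∸m]≡n i<H))
      where
      lemma : ∀ i j → 1 + 2 * i + (1 + 2 * j) ≡ 2 * (suc i + j)
      lemma = solve-∀
    sum%N≡0 : (hash i x + hash j x) % N ≡ 0
    sum%N≡0 = begin-equality
      (a * toℕ x % N + b * toℕ x % N) % N      ≡⟨ %-distribˡ-+ (a * toℕ x) (b * toℕ x) N ⟨
      (a * toℕ x + b * toℕ x) % N              ≡⟨ cong (_% N) (*-distribʳ-+ (toℕ x) a b) ⟨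
      ((a + b) * toℕ x) % N                    ≡⟨ cong (λ z → z * toℕ x % N) a+b≡N ⟩
      (N * toℕ x) % N                          ≡⟨ n∣m⇒m%n≡0 _ N (m∣m*n (toℕ x)) ⟩
      0                                        ∎
    hash≢0 : hash i x ≢ 0
    hash≢0 h≡0 = >⇒∤ {{≢-nonZero x≢0}} (Fin.toℕ<n x)
      (2^k∣m*odd⇒2^k∣m (suc k) (toℕ x) i (subst (N ∣_) (*-comm a (toℕ x)) (m%n≡0⇒n∣m _ N h≡0)))
    exact : N ∣ hash i x + hash j x → hash i x + hash j x ≡ N
    exact (divides 0 eq) = contradiction (m+n≡0⇒m≡0 (hash i x) eq) hash≢0
    exact (divides 1 eq) = trans eq (*-identityˡ N)
    exact (divides (suc (suc q)) eq) = contradiction (begin-strict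
      N + N                      ≤⟨ +-monoʳ-≤ N (m≤m+n N (q * N)) ⟩
      suc (suc q) * N            ≡⟨ eq ⟨
      hash i x + hash j x        <⟨ +-mono-< (hash<N i x) (hash<N j x) ⟩
      N + N                      ∎) (<-irrefl refl)

  -- With `h + h′ = N`, exactly one of `h ≤ t` and `h′ ≤ N ∸ suc t` holds. Reversing both indices
  -- permutes the outcomes, so at least half of them are good.
  goods-bound-symmetric : ¬ partialSum support all ≈ ε → ¬ Any (λ x → toℕ x ≡ 0) support → H * N ≤ 2 * goods
  goods-bound-symmetric total≉ε 0∉ = begin
    H * N
      ≡⟨ cong (H *_) (*-identityʳ N) ⟨
    H * (N * 1)
      ≡⟨ trans (∑<-cong H λ _ → ∑<-const 1 N) (∑<-const (N * 1) H) ⟨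
    (∑[ _ < H ] ∑[ _ < N ] 1)
      ≤⟨ ∑<-mono H (λ i<H → ∑<-mono N λ t<N → one i<H t<N) ⟩
    (∑[ i < H ] ∑[ t < N ] (good i t + good (H ∸ suc i) (N ∸ suc t)))
      ≡⟨ trans (∑<-cong H λ {i} _ → ∑<-+ (good i) (λ t → good (H ∸ suc i) (N ∸ suc t)) N)
           (∑<-+ (λ i → ∑< N (good i)) (λ i → ∑[ t < N ] good (H ∸ suc i) (N ∸ suc t)) H) ⟩
    goods + (∑[ i < H ] ∑[ t < N ] good (H ∸ suc i) (N ∸ suc t))
      ≡⟨ cong (goods +_) (trans (∑<-cong H λ {i} _ → ∑<-reverse N (good (H ∸ suc i)))
           (∑<-reverse H (λ i → ∑< N (good i)))) ⟩
    goods + goods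
      ≡⟨ cong (goods +_) (+-identityʳ goods) ⟨
    2 * goods ∎
    where
    open ≤-Reasoning
    complementary : ∀ h h′ {t} → h + h′ ≡ N → t < N → 1 ≡ ⟦ h ≤? t ⟧ + ⟦ h′ ≤? N ∸ suc t ⟧
    complementary h h′ {t} h+h′≡N t<N = helper (h ≤? t)
      where
      helper : (d : Dec (h ≤ t)) → 1 ≡ ⟦ d ⟧ + ⟦ h′ ≤? N ∸ suc t ⟧
      helper (yes h≤t) = sym (cong suc (⟦⟧-false (h′ ≤? N ∸ suc t) λ h′≤ →
        <⇒≱ (+-cancelʳ-≤ h′ (suc t) h (begin
          suc t + h′               ≤⟨ +-monoʳ-≤ (suc t) h′≤ ⟩
          suc t + (N ∸ suc t)      ≡⟨ m+[n∸m]≡n t<N ⟩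
          N                        ≡⟨ h+h′≡N ⟨
          h + h′                   ∎)) h≤t))
      helper (no h≰t)  = sym (⟦⟧-true (h′ ≤? N ∸ suc t) (m+n≤o⇒m≤o∸n h′ (begin
        h′ + suc t      ≤⟨ +-monoʳ-≤ h′ (≰⇒> h≰t) ⟩
        h′ + h          ≡⟨ +-comm h′ h ⟩
        h + h′          ≡⟨ h+h′≡N ⟩
        N               ∎)))
    reflect< : ∀ {m n} → m < n → n ∸ suc m < n
    reflect< m<n = ∸-monoʳ-< z<s m<n
    one : ∀ {i t} → i < H → t < N → 1 ≤ good i t + good (H ∸ suc i) (N ∸ suc t)
    one {i} {t} i<H t<N = ⟦⟧≤+ (yes tt) (good? _) (good? _) λ _ ¬good ¬good′ →
      ¬good⇒zero i<H t<N ¬good λ sum≈ε → ¬good⇒zero (reflect< i<H) (reflect< t<N) ¬good′ λ sum′≈ε →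
        total≉ε (≈-trans
          (partialSum-disjoint support {all} {sample (suc k) (1 + 2 * i) t} {sample (suc k) (1 + 2 * (H ∸ suc i)) (N ∸ suc t)}
            λ {x} x∈ → complementary (hash i x) (hash (H ∸ suc i) x) (hash-negate x i<H λ x≡0 → 0∉ (lose x∈ x≡0)) t<N)
          (≈-trans (∙-cong sum≈ε sum′≈ε) (identityˡ ε)))

  goods-bound : Dec (partialSum support all ≈ ε) → H * N ≤ 8 * goods
  goods-bound (yes total≈ε) = goods-bound-isolated (inj₁ total≈ε)
  goods-bound (no total≉ε) with any? (λ x → toℕ x ≟ 0) support
  ... | yes 0∈ = goods-bound-isolated (inj₂ 0∈)
  ... | no  0∉ = ≤-trans (goods-bound-symmetric total≉ε 0∉) (*-monoˡ-≤ goods {2} {8} (s≤s (s≤s z≤n)))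

  odds : List ℕ
  odds = map (λ i → 1 + 2 * i) (downFrom H)

  outcomes : List (ℕ × ℕ)
  outcomes = filter good? (cartesianProduct odds (downFrom N))

  outcomes-unique : Unique outcomes
  outcomes-unique = filter⁺ good? (cartesianProduct⁺
    (map⁺ (λ {i} {j} eq → *-cancelˡ-≡ i j 2 (suc-injective eq)) (downFrom⁺ H)) (downFrom⁺ N))

  outcomes-good : All (GoodOutcome R (suc k) v) outcomes
  outcomes-good = all-filter good? (cartesianProduct odds (downFrom N))

  length-outcomes : length outcomes ≡ goods
  length-outcomes = trans (length-filter≡∑ good? (cartesianProduct odds (downFrom N)))
    (trans (∑-cartesianProduct (λ o → ⟦ good? o ⟧) odds (downFrom N))
      (∑-map (λ i → 1 + 2 * i) (λ a → ∑[ t < N ] ⟦ good? (a , t) ⟧) (downFrom H)))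

-- Decidability under double negation

¬¬-decidable : ∀ {ℓ n} (P : Fin n → Set ℓ) → ¬ ¬ (∀ i → Dec (P i))
¬¬-decidable P = Fin.sequence (RawMonad.rawApplicative ¬¬-Monad) λ _ → ¬¬-excluded-middle

-- Double negation commutes with finite products only. Pairs outside the range are refuted by the
-- bounds in `GoodOutcome`, which leaves finitely many to decide.
GoodOutcome-¬¬-decidable : ∀ {c ℓ} (R : CommutativeMonoid c ℓ) w v → ¬ ¬ (∀ o → Dec (GoodOutcome R w v o))
GoodOutcome-¬¬-decidable R w v ¬dec =
  Fin.sequence (RawMonad.rawApplicative ¬¬-Monad)
    (λ (a : Fin (2 ^ w)) → ¬¬-decidable λ (t : Fin (2 ^ w)) → GoodOutcome R w v (toℕ a , toℕ t))
    λ dec → ¬dec (extend dec)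
  where
  extend : (∀ (a t : Fin (2 ^ w)) → Dec (GoodOutcome R w v (toℕ a , toℕ t))) → ∀ o → Dec (GoodOutcome R w v o)
  extend dec (a , t) with a <? 2 ^ w | t <? 2 ^ w
  ... | no  a≮ | _       = no λ (a< , _) → a≮ a<
  ... | yes _  | no  t≮  = no λ (_ , _ , t< , _) → t≮ t<
  ... | yes a< | yes t<  = subst₂ (λ a t → Dec (GoodOutcome R w v (a , t)))
    (Fin.toℕ-fromℕ< a<) (Fin.toℕ-fromℕ< t<) (dec (fromℕ< a<) (fromℕ< t<))

-- The probability is a ratio of counts: `2 ^ (w ∸ 1)` odd multipliers times `2 ^ w` thresholds
-- against a duplicate-free list of good outcomes. The double negation accounts for an arbitrary
-- equality in `R`.
theorem10 : ∀ {c ℓ} (R : CommutativeMonoid c ℓ) (w : ℕ) → 1 ≤ w →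
    (v : Fin (2 ^ w) → CommutativeMonoid.Carrier R) →
    (∃[ x ] ¬ CommutativeMonoid._≈_ R (v x) (CommutativeMonoid.ε R)) →
    ¬ ¬ (∃[ L ] (Unique {A = ℕ × ℕ} L × All (GoodOutcome R w v) L ×
    2 ^ (w ∸ 1) * 2 ^ w ≤ 8 * length L))
theorem10 R (suc k) _ v (x₀ , vx₀≉ε) ¬goal =
  -- What remains to be proved is absurdity, so three decisions may be assumed: which values vanish,
  -- which outcomes are good, and whether the total vanishes.
  ¬¬-decidable (λ x → CommutativeMonoid._≈_ R (v x) (CommutativeMonoid.ε R)) λ v≈ε? →
  GoodOutcome-¬¬-decidable R (suc k) v λ good? →
  let open Counting R k v v≈ε? x₀ vx₀≉ε good? in
  ¬¬-excluded-middle λ total? →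
  ¬goal (outcomes , outcomes-unique , outcomes-good ,
    subst (λ m → 2 ^ k * 2 ^ suc k ≤ 8 * m) (sym length-outcomes) (goods-bound total?))
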